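{- Let $G\cong K_{A_1,\ldots,A_r}$ be a complete multipartite graph on $V=A_1\sqcup\cdots\sqcup A_r$, with $r\ge 2$. Then $G$ is Hall-universal if and only if $$|V|-\max_i|A_i|\le 2\qquad\text{or}\qquad 2\max_i|A_i|-|V|\le 2.$$
   Context: All graphs are finite and simple. For a finite set $V$, $\mathcal G(V)$ denotes the set of all finite simple undirected graphs with vertex set $V$, and $N_G(v)$ is the (open) neighborhood of $v$ in $G$. List coloring: for a graph $H$, a set of colors $S$ and $L:V(H)\to 2^S$, $H$ is $L$-colorable if there is a map $\varphi:V(H)\to S$ with $\varphi(v)\in L(v)$ for all $v$ and $\varphi(u)\ne\varphi(v)$ for every edge $uv\in E(H)$. For a subgraph $F$ of $H$ and $\sigma\in S$, $\alpha(F,L,\sigma)$ is the maximum size of an independent set $X\subseteq V(F)$ of $F$ with $\sigma\in L(v)$ for all $v\in X$. The pair $(H,L)$ satisfies Hall's condition if $|V(F)|\le\sum_{\sigma\in S}\alpha(F,L,\sigma)$ for every subgraph $F$ of $H$. Graphic lists: for $G,H\in\mathcal G(V)$, let $L(v)=N_G(v)$ for all $v\in V$ (with color set $S=V$). $H$ is $G$-colorable if $H$ is $L$-colorable, and $(H,G)$ satisfies Hall's condition if $(H,L)$ does. A graph $G\in\mathcal G(V)$ is Hall-universal if, for every $H\in\mathcal G(V)$ such that $(H,G)$ satisfies Hall's condition, $H$ is $G$-colorable. $K_{A_1,\ldots,A_r}$ is the complete multipartite graph with (nonempty) parts $A_1,\ldots,A_r$: two vertices are adjacent if and only if they lie in different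 parts. -}

module Defs where

open import Level using (0ℓ)
open import Data.Nat.Base using (ℕ; zero; suc; _≤_; _⊔_)
open import Data.Nat.Properties using (+-0-commutativeMonoid)
open import Data.Fin.Base using (Fin)
open import Data.Fin.Properties using (_≟_; any?; all?)
open import Data.Fin.Permutation using (Permutation; _⟨$⟩ʳ_)
open import Data.Fin.Subset using (Subset; inside; outside; _∈_; _⊆_; ∣_∣; Nonempty)
open import Data.Fin.Subset.Properties using (_∈?_; _⊆?_)
open import Data.List.Base as List using (List; _++_; filter)
open import Data.List.Extrema.Nat using (max)
open import Data.Product using (∃; ∃₂; ∃!; _×_; _,_; proj₁; proj₂)
open import Data.Vec.Base using ([]; _∷_; tabulate)
open import Data.Vec.Functional using (foldr)
open import Function.Bundles using (_⇔_)
open import Relation.Binary.Core using (Rel)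
open import Relation.Binary.Definitions using (Decidable; Symmetric; Irreflexive)
open import Relation.Binary.PropositionalEquality using (_≡_; _≢_; refl; sym; trans)
open import Relation.Nullary using (¬_; does)
open import Relation.Nullary.Decidable using (_×-dec_; _→-dec_; ¬?)
import Relation.Unary as U
open import Algebra.Properties.CommutativeMonoid.Sum +-0-commutativeMonoid using (sum)

private
  variable
    n s r : ℕ

record Graph (n : ℕ) : Set₁ where
  field
    Adj        : Rel (Fin n) 0ℓ
    adj?       : Decidable Adj
    adj-sym    : Symmetric Adj
    adj-irrefl : Irreflexive _≡_ Adj

open Graph public

neighborhood : Graph n → Fin n → Subset n
neighborhood G v = tabulate (λ u → does (adj? G v u))

infix 4 _≅_

record _≅_ (G H : Graph n) : Set where
  field
    bijection : Permutation n n
    preserves : ∀ u v → Adj G u v ⇔ Adj H (bijection ⟨$⟩ʳ u) (bijection ⟨$⟩ʳ v)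

-- Subgraphs need not be induced.  Irreflexivity is inherited from H.
record Subgraph (H : Graph n) : Set₁ where
  field
    V       : Subset n
    E       : Rel (Fin n) 0ℓ
    E?      : Decidable E
    E-sym   : Symmetric E
    E⊆Adj   : ∀ {u v} → E u v → Adj H u v
    E-verts : ∀ {u v} → E u v → u ∈ V × v ∈ V

-- List assignments, with colour set Fin s.
Lists : ℕ → ℕ → Set
Lists n s = Fin n → Subset s

Colorable : Graph n → Lists n s → Set
Colorable {n} {s} H L =
  ∃ λ (φ : Fin n → Fin s) →
    (∀ v → φ v ∈ L v) × (∀ u v → Adj H u v → φ u ≢ φ v)

module _ {H : Graph n} (F : Subgraph H) (L : Lists n s) (σ : Fin s) where
  open Subgraph F

  ColorIndependent : Subset n → Set
  ColorIndependent X =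
    X ⊆ V ×
    (∀ u → u ∈ X → ∀ v → v ∈ X → ¬ E u v) ×
    (∀ v → v ∈ X → σ ∈ L v)

  colorIndependent? : U.Decidable ColorIndependent
  colorIndependent? X =
    (X ⊆? V) ×-dec
    all? (λ u → (u ∈? X) →-dec all? (λ v → (v ∈? X) →-dec ¬? (E? u v))) ×-dec
    all? (λ v → (v ∈? X) →-dec (σ ∈? L v))

subsets : ∀ n → List (Subset n)
subsets zero    = List.[ [] ]
subsets (suc n) = List.map (inside ∷_) (subsets n) ++ List.map (outside ∷_) (subsets n)

-- The default value 0 is harmless: the empty set is always admissible.
α : {H : Graph n} → Subgraph H → Lists n s → Fin s → ℕ
α {n} F L σ = max 0 (List.map ∣_∣ (filter (colorIndependent? F L σ) (subsets n)))

HallCondition : Graph n → Lists n s → Set₁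
HallCondition H L =
  (F : Subgraph H) → ∣ Subgraph.V F ∣ ≤ sum (λ σ → α F L σ)

HallUniversal : Graph n → Set₁
HallUniversal {n} G =
  (H : Graph n) → HallCondition H (neighborhood G) → Colorable H (neighborhood G)

record Partition (n r : ℕ) : Set where
  field
    part     : Fin r → Subset n
    nonempty : ∀ i → Nonempty (part i)
    covers   : ∀ v → ∃! _≡_ (λ i → v ∈ part i)

open Partition public

maxPart : Partition n r → ℕ
maxPart A = foldr _⊔_ 0 (λ i → ∣ part A i ∣)

completeMultipartite : Partition n r → Graph n
completeMultipartite A = record
  { Adj        = λ u v → ∃₂ λ i j → i ≢ j × u ∈ part A i × v ∈ part A j
  ; adj?       = λ u v → any? λ i → any? λ j →
                   ¬? (i ≟ j) ×-dec (u ∈? part A i) ×-dec (v ∈? part A j)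
  ; adj-sym    = λ (i , j , i≢j , u∈ , v∈) → j , i , (λ j≡i → i≢j (sym j≡i)) , v∈ , u∈
  ; adj-irrefl = λ { {u} refl (i , j , i≢j , u∈i , u∈j) →
                   let unique = proj₂ (proj₂ (covers A u))
                   in i≢j (trans (sym (unique u∈i)) (unique u∈j)) }
  }

{-# OPTIONS --safe #-}
module Submission where

-- Let M be a largest part of G and N the set of the other vertices.  Every vertex of M has the list N,
-- and the list of every other vertex contains M.
--
-- Sufficiency.  If N is larger than M, no part has more than half of the vertices, so some permutation
-- of V sends every vertex into another part (deranging-permutation); the vertices are repaired one
-- at a time by exchanging two images.  Such a permutation colours every graph H.  Otherwise the vertices
-- of N can get distinct colours from M (extend-colouring), so that it remains to colour H[M] with the
-- colours N.  Hall's condition bounds every T inside M by |N| times the independence number of H[T]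
-- (hall-bound).
--  * Let |M| be at most |N| + 2.  By the bound, a subset of M with more than |N| vertices is not a clique
--    (nonedge).  If |M| = |N| + 1, one pair of non-adjacent vertices shares a colour.  If |M| = |N| + 2,
--    deleting one vertex leaves another such pair, and there are two disjoint non-adjacent pairs or
--    an independent triple; giving one colour to each leaves |N| classes (colourable-if-balanced).
--  * Let |N| be at most 2.  An odd cycle on 2h + 1 vertices has independence number at most h, so the bound
--    excludes it and H[M] is bipartite; if |N| is less than 2, the bound leaves no edge or no
--    vertex in M (colourable-if-few-outside).  That a graph without odd cycles is 2-colourable is shown
--    by inserting its edges one by one, keeping for any two vertices of a component a simple
--    path of the parity that their colours prescribe (oddCycle⊎twoColouring).
--
-- Necessity.  Let |N| = k + 3 and |M| at least |N| + 3.  Inside M, place the join of a 5-cycle with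
-- a complete graph on k + 1 vertices, and let H have no other edges.  The complete graph uses k + 1 colours
-- and leaves two for the 5-cycle, so H is not colourable.  Hall's condition holds nevertheless: a subgraph that
-- lacks a vertex of the 5-cycle is colourable, and in one that contains the 5-cycle, independent sets
-- overlapping in one vertex have the required total size (module Counterexample).

open import Defs
open import Data.Nat.Base using (ℕ; _≤_)
open import Data.Integer.Base using (+_; _-_) renaming (_≤_ to _≤ᶻ_; _*_ to _*ᶻ_)
open import Data.Sum.Base using (_⊎_)
open import Function.Bundles using (_⇔_)

import Data.Nat.Properties as ℕ
import Data.Nat.Properties as ℕ
open import Algebra.Properties.CommutativeMonoid.Sum ℕ.+-0-commutativeMonoid using (sum)
open import Data.Bool.Base using (Bool; true; false; not; _xor_; if_then_else_)
import Data.Bool.Properties as Bool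
open import Data.Bool.Solver using (module xor-∧-Solver)
open import Data.Empty using (⊥-elim)
open import Data.Fin.Base using (Fin; zero; suc; toℕ; splitAt; join; _↑ˡ_)
open import Data.Fin.Patterns using (0F; 1F; 2F; 3F; 4F)
open import Data.Fin.Permutation using (Permutation; _⟨$⟩ʳ_; _⟨$⟩ˡ_; inverseˡ; inverseʳ; transpose; _∘ₚ_)
  renaming (id to idₚ)
open import Data.Fin.Properties
  using (_≟_; any?; all?; join-splitAt; splitAt-join; ↑ˡ-injective; suc-injective)
open import Data.Fin.Subset using (Subset; inside; outside; _∈_; _∉_; _⊆_; ∣_∣; Nonempty; _∪_; ∁; ⊤)
  renaming (⊥ to ∅; _-_ to _∖_)
open import Data.Fin.Subset.Properties
open import Data.Integer.Base using (+≤+) renaming (_+_ to _+ᶻ_; -_ to -ᶻ_)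
import Data.Integer.Properties as ℤ
open import Data.List.Base as List using (List; []; _∷_; _++_; length; filter; allFin; cartesianProduct)
open import Data.List.Extrema.Nat using (max≤v⁺; xs≤max)
import Data.List.Membership.DecPropositional as DecMembership
open import Data.List.Membership.Propositional using () renaming (_∈_ to _∈ˡ_)
open import Data.List.Membership.Propositional.Properties
  using (∈-filter⁺; ∈-filter⁻; ∈-allFin; ∈-map⁺; ∈-map⁻; ∈-++⁺ˡ; ∈-++⁺ʳ; ∈-cartesianProduct⁺)
open import Data.List.Relation.Unary.All as All using (All; []; _∷_)
import Data.List.Relation.Unary.All.Properties as All
open import Data.List.Relation.Unary.AllPairs using ([]; _∷_)
open import Data.List.Relation.Unary.Any using (here; there)
open import Data.List.Relation.Unary.Unique.Propositional using (Unique)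
import Data.List.Relation.Unary.Unique.Propositional.Properties as Unique
open import Data.Nat.Base using (zero; suc; _<_; _+_; _*_; _∸_; _⊔_; z≤n; s≤s)
open import Data.Nat.DivMod using (_%_)
open import Data.Product using (∃; ∃₂; _×_; _,_; proj₁; proj₂)
open import Data.Sum.Base as Sum using (inj₁; inj₂; [_,_]′)
open import Data.Unit.Base using (tt) renaming (⊤ to Unit)
open import Data.Vec.Base using (here; there; lookup; tabulate; []; _∷_)
open import Data.Vec.Functional using (foldr)
open import Data.Vec.Properties using (lookup∘tabulate; []=⇒lookup; lookup⇒[]=)
open import Function.Base using (_∘_; id)
open import Function.Bundles using (mk⇔; Equivalence)
open import Relation.Binary.Definitions using (Decidable; Symmetric)
open import Relation.Binary.PropositionalEquality
open import Relation.Nullary using (¬_; Dec; yes; no; does)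
open import Relation.Nullary.Decidable
  using (dec-true; from-yes; map′; _×-dec_; _⊎-dec_; _→-dec_; ¬?; decidable-stable)
import Relation.Unary as U
open xor-∧-Solver using (solve; _:+_; _:=_; con)

private
  variable
    k m n r s : ℕ

-- Subsets of Fin n and their cardinalities

-- The subset of Fin n cut out by a decidable predicate.
⟦_⟧ : {P : Fin n → Set} → U.Decidable P → Subset n
⟦ P? ⟧ = tabulate (λ x → does (P? x))

∈⟦⟧⁺ : {P : Fin n → Set} (P? : U.Decidable P) {x : Fin n} → P x → x ∈ ⟦ P? ⟧
∈⟦⟧⁺ P? {x} Px =
  lookup⇒[]= x _ (trans (lookup∘tabulate (λ y → does (P? y)) x) (dec-true (P? x) Px))

∈⟦⟧⁻ : {P : Fin n → Set} (P? : U.Decidable P) {x : Fin n} → x ∈ ⟦ P? ⟧ → P x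
∈⟦⟧⁻ P? {x} x∈ with P? x | trans (sym (lookup∘tabulate (λ y → does (P? y)) x)) ([]=⇒lookup x∈)
... | yes Px | _ = Px
... | no _   | ()

-- Distinct list entries mapped injectively into T bound ∣ T ∣ from below.
length≤card : {A : Set} (f : A → Fin n) (l : List A) → Unique l → (T : Subset n) →
  (∀ {x} → x ∈ˡ l → f x ∈ T) → (∀ {x y} → x ∈ˡ l → y ∈ˡ l → f x ≡ f y → x ≡ y) →
  length l ≤ ∣ T ∣
length≤card f []      _            T _  _   = z≤n
length≤card f (x ∷ l) (x∉l ∷ uniq) T f∈ inj = ℕ.≤-trans (s≤s rest) (x∈p⇒∣p-x∣<∣p∣ (f∈ (here refl)))
  where
  rest : length l ≤ ∣ T ∖ f x ∣
  rest = length≤card f l uniq (T ∖ f x)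
    (λ y∈ → x∈p∧x≢y⇒x∈p-y (f∈ (there y∈))
      (λ fy≡fx → All.lookup x∉l y∈ (sym (inj (there y∈) (here refl) fy≡fx))))
    (λ y∈ z∈ → inj (there y∈) (there z∈))

-- Exact when x belongs to S; only the inequality is needed.
card≤suc-remove : (S : Subset n) (x : Fin n) → ∣ S ∣ ≤ suc ∣ S ∖ x ∣
card≤suc-remove (inside  ∷ S) zero    = s≤s (p⊆q⇒∣p∣≤∣q∣ {p = S} (λ y∈ → x∈p∧x∉q⇒x∈p─q y∈ ∉⊥))
card≤suc-remove (outside ∷ S) zero    = ℕ.m≤n⇒m≤1+n (p⊆q⇒∣p∣≤∣q∣ {p = S} (λ y∈ → x∈p∧x∉q⇒x∈p─q y∈ ∉⊥))
card≤suc-remove (inside  ∷ S) (suc x) = s≤s (card≤suc-remove S x)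
card≤suc-remove (outside ∷ S) (suc x) = card≤suc-remove S x

∈-remove⁻ : (S : Subset n) {x y : Fin n} → y ∈ S ∖ x → y ∈ S × y ≢ x
∈-remove⁻ (inside ∷ S) {zero}  {suc y} (there y∈) = there (p─q⊆p S _ y∈) , λ ()
∈-remove⁻ (outside ∷ S) {zero}  {suc y} (there y∈) = there (p─q⊆p S _ y∈) , λ ()
∈-remove⁻ (inside ∷ S) {suc x} {zero}  here       = here , λ ()
∈-remove⁻ (_ ∷ S) {suc x} {suc y} (there y∈) with ∈-remove⁻ S {x} {y} y∈
... | y∈S , y≢x = there y∈S , λ { refl → y≢x refl }

card≤length : (S : Subset n) (l : List (Fin n)) → (∀ {x} → x ∈ S → x ∈ˡ l) → ∣ S ∣ ≤ length l
card≤length {n} S [] S⊆ = subst (∣ S ∣ ≤_) (∣⊥∣≡0 n) (p⊆q⇒∣p∣≤∣q∣ {p = S} {q = ∅} (λ x∈ → ⊥-elim (¬∈[] (S⊆ x∈))))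
  where
  ¬∈[] : ∀ {x : Fin n} → ¬ x ∈ˡ []
  ¬∈[] ()
card≤length S (y ∷ l) S⊆ = ℕ.≤-trans (card≤suc-remove S y) (s≤s (card≤length (S ∖ y) l rest))
  where
  rest : ∀ {x} → x ∈ S ∖ y → x ∈ˡ l
  rest x∈ with ∈-remove⁻ S x∈
  ... | x∈S , x≢y with S⊆ x∈S
  ...   | here x≡y  = ⊥-elim (x≢y x≡y)
  ...   | there x∈l = x∈l

-- The list of members of a subset, in increasing order.
elements : Subset n → List (Fin n)
elements {n} S = filter (_∈? S) (allFin n)

elements-unique : (S : Subset n) → Unique (elements S)
elements-unique {n} S = Unique.filter⁺ (_∈? S) (Unique.allFin⁺ n)

∈-elements⁺ : (S : Subset n) {x : Fin n} → x ∈ S → x ∈ˡ elements S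
∈-elements⁺ S {x} x∈ = ∈-filter⁺ (_∈? S) (∈-allFin x) x∈

∈-elements⁻ : (S : Subset n) {x : Fin n} → x ∈ˡ elements S → x ∈ S
∈-elements⁻ {n} S x∈ = proj₂ (∈-filter⁻ (_∈? S) {xs = allFin n} x∈)

-- A map sending S into T, injective on S, shows that S has at most as many elements as T.
card-injection : (f : Fin m → Fin n) (S : Subset m) (T : Subset n) →
  (∀ {x} → x ∈ S → f x ∈ T) → (∀ {x y} → x ∈ S → y ∈ S → f x ≡ f y → x ≡ y) →
  ∣ S ∣ ≤ ∣ T ∣
card-injection f S T f∈ inj = ℕ.≤-trans
  (card≤length S (elements S) (∈-elements⁺ S))
  (length≤card f (elements S) (elements-unique S) T (f∈ ∘ ∈-elements⁻ S)
    (λ x∈ y∈ → inj (∈-elements⁻ S x∈) (∈-elements⁻ S y∈)))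

card-∪ : (S T : Subset n) → ∣ S ∪ T ∣ ≤ ∣ S ∣ + ∣ T ∣
card-∪ []            []            = z≤n
card-∪ (outside ∷ S) (outside ∷ T) = card-∪ S T
card-∪ (outside ∷ S) (inside  ∷ T) rewrite ℕ.+-suc ∣ S ∣ ∣ T ∣ = s≤s (card-∪ S T)
card-∪ (inside  ∷ S) (outside ∷ T) = s≤s (card-∪ S T)
card-∪ (inside  ∷ S) (inside  ∷ T) = s≤s (ℕ.≤-trans (card-∪ S T) (ℕ.+-monoʳ-≤ ∣ S ∣ (ℕ.n≤1+n _)))

empty⇒card≡0 : (S : Subset n) → ¬ Nonempty S → ∣ S ∣ ≡ 0
empty⇒card≡0 {n} S empty = trans (cong ∣_∣ (Empty-unique empty)) (∣⊥∣≡0 n)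

card>0⇒nonempty : (S : Subset n) → 1 ≤ ∣ S ∣ → Nonempty S
card>0⇒nonempty S 1≤ with nonempty? S
... | yes nonempty = nonempty
... | no  empty    = ⊥-elim (ℕ.<⇒≢ 1≤ (sym (empty⇒card≡0 S empty)))

-- The converse of length≤card: a list no longer than ∣ T ∣ has a map into T injective on its entries.
-- The map d only supplies values outside the list.
injection-on-list : (d : Fin m → Fin n) (l : List (Fin m)) (T : Subset n) → Unique l → length l ≤ ∣ T ∣ →
  ∃ λ (f : Fin m → Fin n) → (∀ {x} → x ∈ˡ l → f x ∈ T) × (∀ {x y} → x ∈ˡ l → y ∈ˡ l → f x ≡ f y → x ≡ y)
injection-on-list d []      T _            _   = d , (λ ()) , λ ()
injection-on-list {m} {n} d (x ∷ l) T (_ ∷ uniq) l≤T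
  with card>0⇒nonempty T (ℕ.≤-trans (s≤s z≤n) l≤T)
... | t , t∈T with injection-on-list d l (T ∖ t) uniq (ℕ.≤-pred (ℕ.≤-trans l≤T (card≤suc-remove T t)))
...   | f , f∈ , inj = g , g∈ , g-inj
  where
  g : Fin m → Fin n
  g y with y ≟ x
  ... | yes _ = t
  ... | no  _ = f y
  g∈ : ∀ {y} → y ∈ˡ x ∷ l → g y ∈ T
  g∈ {y} y∈ with y ≟ x
  g∈ {y} y∈          | yes _   = t∈T
  g∈ {y} (here y≡x)  | no y≢x  = ⊥-elim (y≢x y≡x)
  g∈ {y} (there y∈l) | no _    = proj₁ (∈-remove⁻ T (f∈ y∈l))
  g-inj : ∀ {y z} → y ∈ˡ x ∷ l → z ∈ˡ x ∷ l → g y ≡ g z → y ≡ z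
  g-inj {y} {z} y∈ z∈ eq with y ≟ x | z ≟ x
  g-inj _ _ _ | yes y≡x | yes z≡x = trans y≡x (sym z≡x)
  g-inj _ (here z≡x) _ | yes _ | no z≢x = ⊥-elim (z≢x z≡x)
  g-inj _ (there z∈) eq | yes _ | no _ = ⊥-elim (proj₂ (∈-remove⁻ T (f∈ z∈)) (sym eq))
  g-inj (here y≡x) _ _ | no y≢x | yes _ = ⊥-elim (y≢x y≡x)
  g-inj (there y∈) _ eq | no _ | yes _ = ⊥-elim (proj₂ (∈-remove⁻ T (f∈ y∈)) eq)
  g-inj (here y≡x) _ _ | no y≢x | no _ = ⊥-elim (y≢x y≡x)
  g-inj (there _) (here z≡x) _ | no _ | no z≢x = ⊥-elim (z≢x z≡x)
  g-inj (there y∈) (there z∈) eq | no _ | no _ = inj y∈ z∈ eq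

abstract

  -- The converse of card-injection.  It is abstract because only the stated properties are used,
  -- while unfolding the choices is costly.
  injection : (d : Fin m → Fin n) (S : Subset m) (T : Subset n) → ∣ S ∣ ≤ ∣ T ∣ →
    ∃ λ (f : Fin m → Fin n) → (∀ {x} → x ∈ S → f x ∈ T) × (∀ {x y} → x ∈ S → y ∈ S → f x ≡ f y → x ≡ y)
  injection d S T S≤T =
    let f , f∈ , inj = injection-on-list d (elements S) T (elements-unique S)
          (ℕ.≤-trans (length≤card id (elements S) (elements-unique S) S (∈-elements⁻ S) (λ _ _ eq → eq)) S≤T)
    in f , (λ x∈ → f∈ (∈-elements⁺ S x∈)) , λ x∈ y∈ → inj (∈-elements⁺ S x∈) (∈-elements⁺ S y∈)

  -- A set with at least k elements contains k distinct elements.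
  enumerate : (k : ℕ) (S : Subset n) → k ≤ ∣ S ∣ →
    ∃ λ (f : Fin k → Fin n) → (∀ i → f i ∈ S) × (∀ {i j} → f i ≡ f j → i ≡ j)
  enumerate zero    S _   = (λ ()) , (λ ()) , λ { {()} }
  enumerate (suc k) S k≤S =
    let x , _ = card>0⇒nonempty S (ℕ.≤-trans (s≤s z≤n) k≤S)
        f , f∈ , inj = injection (λ _ → x) ⊤ S (ℕ.≤-trans (ℕ.≤-reflexive (∣⊤∣≡n (suc k))) k≤S)
    in f , (λ i → f∈ {i} ∈⊤) , λ {i} {j} → inj {i} {j} ∈⊤ ∈⊤

sum-mono : (f g : Fin n → ℕ) → (∀ i → f i ≤ g i) → sum f ≤ sum g
sum-mono {zero}  f g f≤g = z≤n
sum-mono {suc n} f g f≤g = ℕ.+-mono-≤ (f≤g zero) (sum-mono (f ∘ suc) (g ∘ suc) (f≤g ∘ suc))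

sum≤card* : (f : Fin n → ℕ) (S : Subset n) (k : ℕ) → (∀ i → f i ≤ k) → (∀ i → i ∉ S → f i ≡ 0) →
  sum f ≤ ∣ S ∣ * k
sum≤card* f []            k f≤ f0 = z≤n
sum≤card* f (inside  ∷ S) k f≤ f0 =
  ℕ.+-mono-≤ (f≤ zero) (sum≤card* (f ∘ suc) S k (f≤ ∘ suc) (λ i i∉ → f0 (suc i) λ { (there i∈) → i∉ i∈ }))
sum≤card* f (outside ∷ S) k f≤ f0 rewrite f0 zero (λ ()) =
  sum≤card* (f ∘ suc) S k (f≤ ∘ suc) (λ i i∉ → f0 (suc i) λ { (there i∈) → i∉ i∈ })

-- Membership in the part of S that φ sends to σ.
fibre? : (S : Subset n) (φ : Fin n → Fin s) (σ : Fin s) → U.Decidable (λ v → v ∈ S × φ v ≡ σ)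
fibre? S φ σ v = (v ∈? S) ×-dec (φ v ≟ σ)

-- A set is the disjoint union of the fibres of any map on it.
card≤sum-fibres : (S : Subset n) (φ : Fin n → Fin s) → ∣ S ∣ ≤ sum (λ σ → ∣ ⟦ fibre? S φ σ ⟧ ∣)
card≤sum-fibres []            φ = z≤n
card≤sum-fibres (outside ∷ S) φ = card≤sum-fibres S (φ ∘ suc)
card≤sum-fibres (inside  ∷ S) φ =
  ℕ.≤-trans (s≤s (card≤sum-fibres S (φ ∘ suc))) (sum-insert (φ zero) (λ σ → ⟦ fibre? S (φ ∘ suc) σ ⟧))
  where
  sum-insert : (c : Fin s) (T : Fin s → Subset n) →
    suc (sum (λ σ → ∣ T σ ∣)) ≤ sum (λ σ → ∣ does (c ≟ σ) ∷ T σ ∣)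
  sum-insert zero    T = ℕ.≤-refl
  sum-insert (suc c) T = ℕ.≤-trans (ℕ.≤-reflexive (sym (ℕ.+-suc ∣ T zero ∣ _)))
    (ℕ.+-monoʳ-≤ ∣ T zero ∣ (sum-insert c (T ∘ suc)))

-- Independent sets, multicolourings and Hall's condition

∈-subsets : (S : Subset n) → S ∈ˡ subsets n
∈-subsets []            = here refl
∈-subsets (inside  ∷ S) = ∈-++⁺ˡ (∈-map⁺ (inside ∷_) (∈-subsets S))
∈-subsets {suc n} (outside ∷ S) =
  ∈-++⁺ʳ (List.map (inside ∷_) (subsets n)) (∈-map⁺ (outside ∷_) (∈-subsets S))

module _ {H : Graph n} (F : Subgraph H) (L : Lists n s) (σ : Fin s) where

  -- The size α is the maximum over the independent sets of vertices whose list contains σ.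
  card≤α : (X : Subset n) → ColorIndependent F L σ X → ∣ X ∣ ≤ α F L σ
  card≤α X ind = All.lookup (xs≤max 0 _)
    (∈-map⁺ ∣_∣ (∈-filter⁺ (colorIndependent? F L σ) (∈-subsets X) ind))

  α≤ : (k : ℕ) → (∀ X → ColorIndependent F L σ X → ∣ X ∣ ≤ k) → α F L σ ≤ k
  α≤ k bound = max≤v⁺ z≤n (All.tabulate λ x∈ →
    let X , X∈ , x≡ = ∈-map⁻ ∣_∣ x∈
    in subst (_≤ k) (sym x≡) (bound X (proj₂ (∈-filter⁻ (colorIndependent? F L σ) {xs = subsets n} X∈))))

-- A multicolouring of F gives each vertex v a colour φ v and a carrier w v whose list contains φ v,
-- such that carriers of one colour are independent and no pair (φ v , w v) is used twice.
-- With w the identity this is a proper colouring of F.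
multicolouring⇒Hall : {H : Graph n} (F : Subgraph H) (L : Lists n s)
  (φ : Fin n → Fin s) (w : Fin n → Fin n) →
  let open Subgraph F in
  (∀ {v} → v ∈ V → w v ∈ V) → (∀ {v} → v ∈ V → φ v ∈ L (w v)) →
  (∀ {u v} → u ∈ V → v ∈ V → φ u ≡ φ v → ¬ E (w u) (w v)) →
  (∀ {u v} → u ∈ V → v ∈ V → φ u ≡ φ v → w u ≡ w v → u ≡ v) →
  ∣ V ∣ ≤ sum (λ σ → α F L σ)
multicolouring⇒Hall {n} {s} F L φ w w∈ φ∈ proper inj =
  ℕ.≤-trans (card≤sum-fibres V φ) (sum-mono _ _ fibre≤α)
  where
  open Subgraph F
  carrier? : (σ : Fin s) → U.Decidable (λ x → ∃ λ v → (v ∈ V × φ v ≡ σ) × w v ≡ x)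
  carrier? σ x = any? λ v → fibre? V φ σ v ×-dec (w v ≟ x)
  fibre≤α : ∀ σ → ∣ ⟦ fibre? V φ σ ⟧ ∣ ≤ α F L σ
  fibre≤α σ = ℕ.≤-trans
    (card-injection w ⟦ fibre? V φ σ ⟧ ⟦ carrier? σ ⟧
      (λ {v} v∈ → ∈⟦⟧⁺ (carrier? σ) (v , ∈⟦⟧⁻ (fibre? V φ σ) v∈ , refl))
      (λ u∈ v∈ wu≡wv →
        let u∈V , φu≡σ = ∈⟦⟧⁻ (fibre? V φ σ) u∈
            v∈V , φv≡σ = ∈⟦⟧⁻ (fibre? V φ σ) v∈
        in inj u∈V v∈V (trans φu≡σ (sym φv≡σ)) wu≡wv))
    (card≤α F L σ ⟦ carrier? σ ⟧
      ( (λ x∈ → let v , (v∈V , _) , wv≡x = ∈⟦⟧⁻ (carrier? σ) x∈ in subst (_∈ V) wv≡x (w∈ v∈V))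
      , (λ x x∈ y y∈ Exy →
          let u , (u∈V , φu≡σ) , wu≡x = ∈⟦⟧⁻ (carrier? σ) x∈
              v , (v∈V , φv≡σ) , wv≡y = ∈⟦⟧⁻ (carrier? σ) y∈
          in proper u∈V v∈V (trans φu≡σ (sym φv≡σ)) (subst₂ E (sym wu≡x) (sym wv≡y) Exy))
      , (λ x x∈ → let v , (v∈V , φv≡σ) , wv≡x = ∈⟦⟧⁻ (carrier? σ) x∈
                  in subst₂ (λ c y → c ∈ L y) φv≡σ wv≡x (φ∈ v∈V))))

-- The subgraph of H induced on T.
induced : (H : Graph n) → Subset n → Subgraph H
induced H T = record
  { V       = T
  ; E       = λ u v → Adj H u v × u ∈ T × v ∈ T
  ; E?      = λ u v → adj? H u v ×-dec ((u ∈? T) ×-dec (v ∈? T))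
  ; E-sym   = λ (uv , u∈ , v∈) → adj-sym H uv , v∈ , u∈
  ; E⊆Adj   = proj₁
  ; E-verts = proj₂
  }

-- If the vertices of T have lists inside N, and independent sets in T have at most k elements,
-- then Hall's condition on T bounds the size of T.
hall-bound : {H : Graph n} {L : Lists n s} → HallCondition H L → (T : Subset n) (N : Subset s) →
  (∀ {v} → v ∈ T → L v ⊆ N) → (k : ℕ) →
  (∀ X → X ⊆ T → (∀ u → u ∈ X → ∀ v → v ∈ X → ¬ Adj H u v) → ∣ X ∣ ≤ k) →
  ∣ T ∣ ≤ ∣ N ∣ * k
hall-bound {n} {s} {H} {L} hall T N L⊆N k bound =
  ℕ.≤-trans (hall F) (sum≤card* _ N k
    (λ σ → α≤ F L σ k λ X (X⊆T , ind , _) → bound X X⊆T λ u u∈ v v∈ uv → ind u u∈ v v∈ (uv , X⊆T u∈ , X⊆T v∈))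
    (λ σ σ∉N → ℕ.n≤0⇒n≡0 (α≤ F L σ 0 λ X (X⊆T , _ , σ∈) →
      subst (∣ X ∣ ≤_) (∣⊥∣≡0 n) (p⊆q⇒∣p∣≤∣q∣ {p = X} {q = ∅} λ {v} v∈ → ⊥-elim (σ∉N (L⊆N (X⊆T v∈) (σ∈ v v∈)))))))
  where
  F : Subgraph H
  F = induced H T

-- Paths, odd cycles and bipartite graphs

-- Walks from u to v with vertex list l; the Boolean is true when the number of edges is odd.
-- Vertices may repeat; simplicity is stated separately as Unique l.
data Path (E : Fin n → Fin n → Set) : Bool → Fin n → Fin n → List (Fin n) → Set where
  stop : ∀ {u} → Path E false u u (u ∷ [])
  step : ∀ {b u x v l} → E u x → Path E b x v l → Path E (not b) u v (u ∷ l)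

module _ {E : Fin n → Fin n → Set} where

  join-paths : ∀ {b c u v x y l l′} → Path E b u v l → E v x → Path E c x y l′ →
    Path E (not (b xor c)) u y (l ++ l′)
  join-paths stop e q = step e q
  join-paths {c = c} (step {b} e′ p) e q =
    subst (λ d → Path E d _ _ _) (parity b c) (step e′ (join-paths p e q))
    where
    parity : ∀ b c → not (not (b xor c)) ≡ not (not b xor c)
    parity false c = refl
    parity true  c = cong not (Bool.not-involutive c)

  length-path : ∀ {b u v l} → Path E b u v l → ∃ λ h → length l ≡ (if b then 2 else 1) + h * 2
  length-path stop = 0 , refl
  length-path (step {false} e p) = let h , eq = length-path p in h , cong suc eq
  length-path (step {true}  e p) = let h , eq = length-path p in suc h , cong suc eq

  All-path : {P : Fin n → Set} → (∀ {x y} → E x y → P y) → ∀ {b u v l} → Path E b u v l → P u → All P l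
  All-path E⇒P stop       Pu = Pu ∷ []
  All-path E⇒P (step e p) Pu = Pu ∷ All-path E⇒P p (E⇒P e)

  module _ (X : Subset n) (ind : ∀ u → u ∈ X → ∀ v → v ∈ X → ¬ E u v) where

    -- The indicator of the complement of X.
    absent : Fin n → ℕ
    absent x with x ∈? X
    ... | yes _ = 0
    ... | no  _ = 1

    -- The number of entries of l in X.
    hits : List (Fin n) → ℕ
    hits l = length (filter (_∈? X) l)

    -- No two consecutive vertices of a path lie in the independent set X, so twice the number of hits exceeds the
    -- number of vertices by at most one, and by one less for each end outside X.
    hits-path : ∀ {b u v l} → Path E b u v l → hits l * 2 + (absent u + absent v) ≤ suc (length l)
    hits-path (stop {u}) with u ∈? X
    ... | yes _ = ℕ.≤-refl
    ... | no  _ = ℕ.≤-refl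
    hits-path {v = v} (step {u = u} {x = x} {l = l} e p) with u ∈? X | x ∈? X | hits-path p
    ... | no  _   | yes _   | ih rewrite ℕ.+-suc (hits l * 2) (absent v) = s≤s ih
    ... | no  _   | no _    | ih = ℕ.≤-trans ih (ℕ.n≤1+n _)
    ... | yes u∈X | yes x∈X | _  = ⊥-elim (ind u u∈X x x∈X e)
    ... | yes _   | no _    | ih rewrite ℕ.+-suc (hits l * 2) (absent v) = s≤s ih

    -- The edge from v back to u prevents X from containing both ends, so the excess of one is lost.
    hits-odd-cycle : ∀ {u v l} → Path E false u v l → E v u → hits l * 2 ≤ length l
    hits-odd-cycle {u} {v} {l} p e with u ∈? X | v ∈? X | hits-path p
    ... | yes u∈X | yes v∈X | _  = ⊥-elim (ind v v∈X u u∈X e)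
    ... | no  _   | yes _   | le rewrite ℕ.+-suc (hits l * 2) 0 | ℕ.+-identityʳ (hits l * 2) = ℕ.≤-pred le
    ... | yes _   | no  _   | le rewrite ℕ.+-suc (hits l * 2) 0 | ℕ.+-identityʳ (hits l * 2) = ℕ.≤-pred le
    ... | no  _   | no  _   | le = ℕ.≤-pred (ℕ.≤-trans (ℕ.≤-trans (ℕ.≤-reflexive (sym (trans (ℕ.+-suc (hits l * 2) 0) (cong suc (ℕ.+-identityʳ _))))) (ℕ.+-monoʳ-≤ (hits l * 2) (s≤s z≤n))) le)

-- A simple path with an even number of edges, closed by one more edge; a loop is the case of one vertex.
OddCycle : (Fin n → Fin n → Set) → Set
OddCycle E = ∃₂ λ u v → ∃ λ l → Path E false u v l × E v u × Unique l

-- A proper colouring with two colours.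
TwoColouring : (Fin n → Fin n → Set) → Set
TwoColouring {n} E = ∃ λ (c : Fin n → Bool) → ∀ u v → E u v → c u ≢ c v

module _ {E : Fin n → Fin n → Set} (E? : Decidable E) (E-sym : Symmetric E) where

  -- The state after inserting the edges among es: a 2-colouring proper on them and a labelling of components.
  -- Any two vertices with the same label are joined by a simple path inside their component, and
  -- the parity of its length tells whether their colours differ.
  record Forest (es : List (Fin n × Fin n)) : Set where
    field
      colour : Fin n → Bool
      comp   : Fin n → Fin n
      proper : ∀ {u v} → (u , v) ∈ˡ es → E u v → colour u ≢ colour v × comp u ≡ comp v
      path   : ∀ u v → comp u ≡ comp v → ∃ λ l →
               Path E (colour u xor colour v) u v l × Unique l × All (λ x → comp x ≡ comp u) l

  -- An edge inside a component either agrees with the colouring or closes an odd cycle; an edge between two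
  -- components merges them.
  grow : ∀ {es} u v → Forest es → OddCycle E ⊎ Forest ((u , v) ∷ es)
  grow {es} u v forest with E? u v
  ... | no ¬uv = inj₂ record
    { colour = colour ; comp = comp ; path = path
    ; proper = λ { (here refl) uv → ⊥-elim (¬uv uv) ; (there e∈) e → proper e∈ e } }
    where open Forest forest
  ... | yes uv with Forest.comp forest u ≟ Forest.comp forest v
  ...   | yes same with Forest.colour forest u Bool.≟ Forest.colour forest v
  ...     | no differ = inj₂ record
    { colour = colour ; comp = comp ; path = path
    ; proper = λ { (here refl) _ → differ , same ; (there e∈) e → proper e∈ e } }
    where open Forest forest
  ...     | yes equal = inj₁ (u , v , l , subst (λ b → Path E b u v l) even p , E-sym uv , uniq)
    where
    open Forest forest
    l = proj₁ (path u v same)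
    p = proj₁ (proj₂ (path u v same))
    uniq = proj₁ (proj₂ (proj₂ (path u v same)))
    even : colour u xor colour v ≡ false
    even rewrite equal = Bool.xor-same (colour v)
  grow {es} u v forest | yes uv | no apart = inj₂ record
    { colour = colour′ ; comp = comp′ ; path = path′
    ; proper = λ { (here refl) _ → crossing ; (there e∈) e → proper′ (proper e∈ e) } }
    where
    open Forest forest
    -- The component of v is recoloured so that v differs from u, and takes the label of u.
    d : Bool
    d = not (colour u xor colour v)
    colour′ : Fin n → Bool
    colour′ x with comp x ≟ comp v
    ... | yes _ = colour x xor d
    ... | no  _ = colour x
    comp′ : Fin n → Fin n
    comp′ x with comp x ≟ comp v
    ... | yes _ = comp u
    ... | no  _ = comp x
    comp′-v : ∀ {x} → comp x ≡ comp v → comp′ x ≡ comp u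
    comp′-v {x} eq with comp x ≟ comp v
    ... | yes _ = refl
    ... | no ne = ⊥-elim (ne eq)
    comp′-other : ∀ {x} → comp x ≢ comp v → comp′ x ≡ comp x
    comp′-other {x} ne with comp x ≟ comp v
    ... | yes eq = ⊥-elim (ne eq)
    ... | no _ = refl
    xor-cancel : ∀ a b c → (a xor c) xor (b xor c) ≡ a xor b
    xor-cancel = solve 3 (λ a b c → (a :+ c) :+ (b :+ c) := a :+ b) refl
    xor-not : ∀ a b → a ≢ b xor not (a xor b)
    xor-not false false ()
    xor-not false true  ()
    xor-not true  false ()
    xor-not true  true  ()
    crossing : colour′ u ≢ colour′ v × comp′ u ≡ comp′ v
    crossing with comp u ≟ comp v | comp v ≟ comp v
    ... | yes eq | _     = ⊥-elim (apart eq)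
    ... | no _   | no ne = ⊥-elim (ne refl)
    ... | no _   | yes _ = xor-not (colour u) (colour v) , refl
    proper′ : ∀ {x y} → colour x ≢ colour y × comp x ≡ comp y → colour′ x ≢ colour′ y × comp′ x ≡ comp′ y
    proper′ {x} {y} (differ , same) with comp x ≟ comp v | comp y ≟ comp v
    ... | yes eq | no ne  = ⊥-elim (ne (trans (sym same) eq))
    ... | no ne  | yes eq = ⊥-elim (ne (trans same eq))
    ... | no _   | no _   = differ , same
    ... | yes _  | yes _  = (λ eq → differ (xor-inj (colour x) (colour y) d eq)) , refl
      where
      xor-inj : ∀ a b c → a xor c ≡ b xor c → a ≡ b
      xor-inj false false c     _ = refl
      xor-inj true  true  c     _ = refl
      xor-inj false true  false ()
      xor-inj false true  true  ()
      xor-inj true  false false ()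
      xor-inj true  false true  ()
    -- Paths in two different components joined by an edge stay simple since the components are disjoint.
    bridge : ∀ {x y a b l l′} → comp a ≢ comp b → E a b →
      Path E (colour x xor colour a) x a l → Unique l → All (λ z → comp z ≡ comp a) l →
      Path E (colour b xor colour y) b y l′ → Unique l′ → All (λ z → comp z ≡ comp b) l′ →
      Path E (not ((colour x xor colour a) xor (colour b xor colour y))) x y (l ++ l′) × Unique (l ++ l′)
    bridge a≢b ab p uniq all p′ uniq′ all′ =
      join-paths p ab p′ ,
      Unique.++⁺ uniq uniq′ (λ (z∈ , z∈′) → a≢b (trans (sym (All.lookup all z∈)) (All.lookup all′ z∈′)))
    parity-vu : ∀ x y a b → not ((x xor b) xor (a xor y)) ≡ (x xor not (a xor b)) xor y
    parity-vu = solve 4 (λ x y a b → con true :+ ((x :+ b) :+ (a :+ y)) := (x :+ (con true :+ (a :+ b))) :+ y) refl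
    parity-uv : ∀ x y a b → not ((x xor a) xor (b xor y)) ≡ x xor (y xor not (a xor b))
    parity-uv = solve 4 (λ x y a b → con true :+ ((x :+ a) :+ (b :+ y)) := x :+ (y :+ (con true :+ (a :+ b)))) refl
    path′ : ∀ x y → comp′ x ≡ comp′ y → ∃ λ l →
      Path E (colour′ x xor colour′ y) x y l × Unique l × All (λ z → comp′ z ≡ comp′ x) l
    path′ x y same with comp x ≟ comp v | comp y ≟ comp v
    ... | yes x~v | yes y~v with path x y (trans x~v (sym y~v))
    ...   | l , p , uniq , all =
      l , subst (λ b → Path E b x y l) (sym (xor-cancel (colour x) (colour y) d)) p , uniq ,
      All.map (λ z~x → comp′-v (trans z~x x~v)) all
    path′ x y same | no x≁v | no _ with path x y same
    ...   | l , p , uniq , all =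
      l , p , uniq , All.map (λ z~x → trans (comp′-other (λ z~v → x≁v (trans (sym z~x) z~v))) z~x) all
    path′ x y same | yes x~v | no y≁v with path x v x~v | path u y same
    ...   | l , p , uniq , all | l′ , p′ , uniq′ , all′
      with bridge (apart ∘ sym) (E-sym uv) p uniq (All.map (λ z~x → trans z~x x~v) all) p′ uniq′ all′
    ...     | q , uniq″ =
      l ++ l′ , subst (λ b → Path E b x y (l ++ l′)) (parity-vu (colour x) (colour y) (colour u) (colour v)) q , uniq″ ,
      All.++⁺ (All.map (λ z~x → comp′-v (trans z~x x~v)) all)
              (All.map (λ z~u → trans (comp′-other (λ z~v → apart (trans (sym z~u) z~v))) z~u) all′)
    path′ x y same | no x≁v | yes y~v with path x u same | path v y (sym y~v)
    ...   | l , p , uniq , all | l′ , p′ , uniq′ , all′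
      with bridge apart uv p uniq (All.map (λ z~x → trans z~x same) all) p′ uniq′ all′
    ...     | q , uniq″ =
      l ++ l′ , subst (λ b → Path E b x y (l ++ l′)) (parity-uv (colour x) (colour y) (colour u) (colour v)) q , uniq″ ,
      All.++⁺ (All.map (λ z~x → trans (comp′-other (λ z~v → x≁v (trans (sym z~x) z~v))) z~x) all)
              (All.map (λ z~v → trans (comp′-v z~v) (sym same)) all′)

  -- Initially every vertex is a component of its own.
  forest : (es : List (Fin n × Fin n)) → OddCycle E ⊎ Forest es
  forest [] = inj₂ record
    { colour = λ _ → false ; comp = id ; proper = λ ()
    ; path = λ { u .u refl → u ∷ [] , stop , [] ∷ [] , refl ∷ [] } }
  forest ((u , v) ∷ es) with forest es
  ... | inj₁ cycle = inj₁ cycle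
  ... | inj₂ f     = grow u v f

  -- A finite graph without odd cycles is bipartite.
  oddCycle⊎twoColouring : OddCycle E ⊎ TwoColouring E
  oddCycle⊎twoColouring with forest (cartesianProduct (allFin n) (allFin n))
  ... | inj₁ cycle = inj₁ cycle
  ... | inj₂ f     = inj₂ (Forest.colour f , λ u v uv →
    proj₁ (Forest.proper f (∈-cartesianProduct⁺ (∈-allFin u) (∈-allFin v)) uv))

-- Sufficiency: colourings

-- The vertices that the map p sends to i; for p the part index, this is one part.
cell : (Fin n → Fin r) → Fin r → Subset n
cell p i = ⟦ (λ v → p v ≟ i) ⟧

-- If no cell of p has more than m elements and 2m is at most n, some permutation moves every vertex
-- of l to another cell.  A vertex v that stays in its cell i exchanges its image with a vertex w such that
-- neither w nor its image is in i; both are then moved, so no earlier vertex is spoilt.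
deranging-permutation : (p : Fin n → Fin r) (m : ℕ) → (∀ i → ∣ cell p i ∣ ≤ m) → m + m ≤ n →
  (l : List (Fin n)) → ∃ λ (π : Permutation n n) → ∀ {v} → v ∈ˡ l → p (π ⟨$⟩ʳ v) ≢ p v
deranging-permutation p m cell≤ 2m≤n [] = idₚ , λ ()
deranging-permutation {n} p m cell≤ 2m≤n (v ∷ l) with deranging-permutation p m cell≤ 2m≤n l
... | π , good with p (π ⟨$⟩ʳ v) ≟ p v
...   | no v-good = π , λ { (here refl) → v-good ; (there x∈) → good x∈ }
...   | yes v-bad with any? (λ w → ¬? (p w ≟ p v) ×-dec ¬? (p (π ⟨$⟩ʳ w) ≟ p v))
...     | yes (w , pw , pπw) = transpose v w ∘ₚ π , λ { (here x≡v) → swapped (inj₁ x≡v) ; (there x∈) → swapped (inj₂ (good x∈)) }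
  where
  swapped : ∀ {x} → x ≡ v ⊎ p (π ⟨$⟩ʳ x) ≢ p x → p (π ⟨$⟩ʳ (transpose v w ⟨$⟩ʳ x)) ≢ p x
  swapped {x} x-ok eq with x ≟ v
  swapped {x} x-ok eq | yes refl = pπw eq
  swapped {x} x-ok eq | no x≢v with x ≟ w
  swapped {x} x-ok eq | no x≢v | yes refl = pw (trans (sym eq) v-bad)
  swapped {x} (inj₁ x≡v) eq | no x≢v | no _ = x≢v x≡v
  swapped {x} (inj₂ x-ok) eq | no _ | no _ = x-ok eq
...     | no none = ⊥-elim (ℕ.<-irrefl refl (ℕ.<-≤-trans n<2m 2m≤n))
  where
  i = p v
  preimage? : U.Decidable (λ w → p (π ⟨$⟩ʳ w) ≡ i)
  preimage? w = p (π ⟨$⟩ʳ w) ≟ i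
  preimage≤ : ∣ ⟦ preimage? ⟧ ∣ ≤ m
  preimage≤ = ℕ.≤-trans
    (card-injection (π ⟨$⟩ʳ_) ⟦ preimage? ⟧ (cell p i)
      (λ {w} w∈ → ∈⟦⟧⁺ (λ v → p v ≟ i) (∈⟦⟧⁻ preimage? w∈))
      (λ {x} {y} _ _ eq → trans (sym (inverseˡ π)) (trans (cong (π ⟨$⟩ˡ_) eq) (inverseˡ π))))
    (cell≤ i)
  -- The vertex v lies in both sets, so removing it from one of them loses nothing.
  covered : ⊤ ⊆ cell p i ∪ (⟦ preimage? ⟧ ∖ v)
  covered {w} _ with p w ≟ i | p (π ⟨$⟩ʳ w) ≟ i
  ... | yes pw | _ = x∈p∪q⁺ (inj₁ (∈⟦⟧⁺ (λ v → p v ≟ i) pw))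
  ... | no pw | no pπw = ⊥-elim (none (w , pw , pπw))
  ... | no pw | yes pπw = x∈p∪q⁺ (inj₂ (x∈p∧x≢y⇒x∈p-y (∈⟦⟧⁺ preimage? pπw) λ { refl → pw refl }))
  n<2m : n < m + m
  n<2m = ℕ.≤-<-trans (ℕ.≤-reflexive (sym (∣⊤∣≡n n)))
    (ℕ.≤-<-trans (p⊆q⇒∣p∣≤∣q∣ covered)
      (ℕ.≤-<-trans (card-∪ (cell p i) (⟦ preimage? ⟧ ∖ v))
        (ℕ.+-mono-≤-< (cell≤ i) (ℕ.<-≤-trans (x∈p⇒∣p-x∣<∣p∣ (∈⟦⟧⁺ preimage? v-bad)) preimage≤))))

-- Lists in which every vertex of M sees exactly the colours outside M, and every other vertex sees at least
-- the colours in M.  The colours are the vertices, and ∁ M is the set N of the introduction.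
module Split {n} (H : Graph n) (L : Lists n n) (M : Subset n)
  (L-inner : ∀ {v} → v ∈ M → L v ⊆ ∁ M)
  (inner-L : ∀ {v} → v ∈ M → ∁ M ⊆ L v)
  (outer-L : ∀ {v} → v ∉ M → M ⊆ L v)
  (∁M≤M : ∣ ∁ M ∣ ≤ ∣ M ∣) where

  -- A colouring of H[M] by ∁ M extends to H: the other vertices get distinct colours of M.
  extend-colouring : (ψ : Fin n → Fin n) → (∀ {v} → v ∈ M → ψ v ∈ ∁ M) →
    (∀ {u v} → u ∈ M → v ∈ M → Adj H u v → ψ u ≢ ψ v) → Colorable H L
  extend-colouring ψ ψ∈ proper = φ , φ∈ , φ-proper
    where
    ι-spec = injection id (∁ M) M ∁M≤M
    ι = proj₁ ι-spec
    ι∈ = proj₁ (proj₂ ι-spec)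
    ι-inj = proj₂ (proj₂ ι-spec)
    φ : Fin n → Fin n
    φ v with v ∈? M
    ... | yes _ = ψ v
    ... | no  _ = ι v
    φ∈ : ∀ v → φ v ∈ L v
    φ∈ v with v ∈? M
    ... | yes v∈ = inner-L v∈ (ψ∈ v∈)
    ... | no v∉  = outer-L v∉ (ι∈ (x∉p⇒x∈∁p v∉))
    φ-proper : ∀ u v → Adj H u v → φ u ≢ φ v
    φ-proper u v uv eq with u ∈? M | v ∈? M
    ... | yes u∈ | yes v∈ = proper u∈ v∈ uv eq
    ... | yes u∈ | no v∉ = x∈∁p⇒x∉p (ψ∈ u∈) (subst (_∈ M) (sym eq) (ι∈ (x∉p⇒x∈∁p v∉)))
    ... | no u∉ | yes v∈ = x∈∁p⇒x∉p (ψ∈ v∈) (subst (_∈ M) eq (ι∈ (x∉p⇒x∈∁p u∉)))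
    ... | no u∉ | no v∉ = adj-irrefl H (ι-inj (x∉p⇒x∈∁p u∉) (x∉p⇒x∈∁p v∉) eq) uv

  -- The fibres of ρ on M are the colour classes, and R has at most as many elements as there are colours for them.
  merge-colouring : (ρ : Fin n → Fin n) (R : Subset n) → ∣ R ∣ ≤ ∣ ∁ M ∣ →
    (∀ {v} → v ∈ M → ρ v ∈ R) →
    (∀ {u v} → u ∈ M → v ∈ M → ρ u ≡ ρ v → ¬ Adj H u v) → Colorable H L
  merge-colouring ρ R R≤ ρ∈ ind =
    let ι , ι∈ , ι-inj = injection id R (∁ M) R≤
    in extend-colouring (ι ∘ ρ) (ι∈ ∘ ρ∈) (λ u∈ v∈ uv eq → ind u∈ v∈ (ι-inj (ρ∈ u∈) (ρ∈ v∈) eq) uv)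

  module _ (hall : HallCondition H L) where

    -- A subset of M with more vertices than there are colours outside M is not a clique.
    nonedge : (T : Subset n) → T ⊆ M → ∣ ∁ M ∣ < ∣ T ∣ →
      ∃₂ λ x y → x ∈ T × y ∈ T × x ≢ y × ¬ Adj H x y
    nonedge T T⊆M big with any? (λ x → any? λ y → (x ∈? T) ×-dec ((y ∈? T) ×-dec (¬? (x ≟ y) ×-dec ¬? (adj? H x y))))
    ... | yes found = found
    ... | no clique = ⊥-elim (ℕ.<-irrefl refl (ℕ.<-≤-trans big (subst (∣ T ∣ ≤_) (ℕ.*-identityʳ ∣ ∁ M ∣)
            (hall-bound hall T (∁ M) (L-inner ∘ T⊆M) 1 singleton))))
      where
      singleton : ∀ X → X ⊆ T → (∀ u → u ∈ X → ∀ v → v ∈ X → ¬ Adj H u v) → ∣ X ∣ ≤ 1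
      singleton X X⊆T ind with nonempty? X
      ... | no  empty = ℕ.≤-trans (card≤length X [] λ x∈ → ⊥-elim (empty (_ , x∈))) z≤n
      ... | yes (x , x∈) = card≤length X (x ∷ []) λ {y} y∈ → here (decidable-stable (y ≟ x) λ y≢x →
              clique (y , x , X⊆T y∈ , X⊆T x∈ , y≢x , ind y y∈ x x∈))

    -- The vertex v takes the colour of u.
    one-merge : ∣ M ∣ ≤ suc ∣ ∁ M ∣ → ∀ {u v} → u ∈ M → v ∈ M → u ≢ v → ¬ Adj H u v → Colorable H L
    one-merge M≤ {u} {v} u∈ v∈ u≢v ¬uv = merge-colouring ρ (M ∖ v)
      (ℕ.≤-pred (ℕ.≤-trans (x∈p⇒∣p-x∣<∣p∣ v∈) M≤)) ρ∈ ind
      where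
      ρ : Fin n → Fin n
      ρ z with z ≟ v
      ... | yes _ = u
      ... | no  _ = z
      ρ∈ : ∀ {z} → z ∈ M → ρ z ∈ M ∖ v
      ρ∈ {z} z∈ with z ≟ v
      ... | yes _  = x∈p∧x≢y⇒x∈p-y u∈ u≢v
      ... | no z≢v = x∈p∧x≢y⇒x∈p-y z∈ z≢v
      ind : ∀ {z t} → z ∈ M → t ∈ M → ρ z ≡ ρ t → ¬ Adj H z t
      ind {z} {t} _ _ eq zt with z ≟ v | t ≟ v
      ... | yes refl | yes refl = adj-irrefl H refl zt
      ... | yes refl | no _     = ¬uv (subst (λ x → Adj H x v) (sym eq) (adj-sym H zt))
      ... | no _     | yes refl = ¬uv (subst (λ x → Adj H x v) eq zt)
      ... | no _     | no _     = adj-irrefl H eq zt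

    -- The vertices v and y take the colours of u and x; when u and x coincide, then u, v and y form one class.
    two-merges : ∣ M ∣ ≤ suc (suc ∣ ∁ M ∣) → ∀ {u v x y} →
      u ∈ M → v ∈ M → x ∈ M → y ∈ M →
      u ≢ v → u ≢ y → x ≢ v → x ≢ y → v ≢ y →
      ¬ Adj H u v → ¬ Adj H x y → (u ≡ x → ¬ Adj H v y) → Colorable H L
    two-merges M≤ {u} {v} {x} {y} u∈ v∈ x∈ y∈ u≢v u≢y x≢v x≢y v≢y ¬uv ¬xy ¬vy =
      merge-colouring ρ (M ∖ v ∖ y)
        (ℕ.≤-pred (ℕ.≤-trans (x∈p⇒∣p-x∣<∣p∣ (x∈p∧x≢y⇒x∈p-y y∈ (v≢y ∘ sym)))
          (ℕ.≤-pred (ℕ.≤-trans (x∈p⇒∣p-x∣<∣p∣ v∈) M≤)))) ρ∈ ind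
      where
      ρ : Fin n → Fin n
      ρ z with z ≟ v | z ≟ y
      ... | yes _ | _     = u
      ... | no  _ | yes _ = x
      ... | no  _ | no  _ = z
      keep : ∀ {z} → z ∈ M → z ≢ v → z ≢ y → z ∈ M ∖ v ∖ y
      keep z∈ z≢v z≢y = x∈p∧x≢y⇒x∈p-y (x∈p∧x≢y⇒x∈p-y z∈ z≢v) z≢y
      ρ∈ : ∀ {z} → z ∈ M → ρ z ∈ M ∖ v ∖ y
      ρ∈ {z} z∈ with z ≟ v | z ≟ y
      ... | yes _  | _      = keep u∈ u≢v u≢y
      ... | no  _  | yes _  = keep x∈ x≢v x≢y
      ... | no z≢v | no z≢y = keep z∈ z≢v z≢y
      ind : ∀ {z t} → z ∈ M → t ∈ M → ρ z ≡ ρ t → ¬ Adj H z t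
      ind {z} {t} _ _ eq zt with z ≟ v | z ≟ y | t ≟ v | t ≟ y
      ... | yes refl | _        | yes refl | _        = adj-irrefl H refl zt
      ... | yes refl | _        | no _     | yes refl = ¬vy eq zt
      ... | yes refl | _        | no _     | no _     = ¬uv (subst (λ a → Adj H a v) (sym eq) (adj-sym H zt))
      ... | no _     | yes refl | yes refl | _        = ¬vy (sym eq) (adj-sym H zt)
      ... | no _     | yes refl | no _     | yes refl = adj-irrefl H refl zt
      ... | no _     | yes refl | no _     | no _     = ¬xy (subst (λ a → Adj H a y) (sym eq) (adj-sym H zt))
      ... | no _     | no _     | yes refl | _        = ¬uv (subst (λ a → Adj H a v) eq zt)
      ... | no _     | no _     | no _     | yes refl = ¬xy (subst (λ a → Adj H a y) eq zt)
      ... | no _     | no _     | no _     | no _     = adj-irrefl H eq zt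

    -- When |M| = |∁ M| + 2, there are two disjoint nonedges or an independent triple: a nonedge u v is
    -- compared with one that avoids u, and, if they share v, with one that avoids v.
    colourable-if-balanced : ∣ M ∣ ≤ suc (suc ∣ ∁ M ∣) → Colorable H L
    colourable-if-balanced M≤ with ∣ M ∣ ℕ.≤? ∣ ∁ M ∣
    ... | yes small = merge-colouring id M small id (λ _ _ eq → adj-irrefl H eq)
    ... | no M≰ with nonedge M id (ℕ.≰⇒> M≰)
    ...   | u , v , u∈ , v∈ , u≢v , ¬uv with ∣ M ∣ ℕ.≤? suc ∣ ∁ M ∣
    ...     | yes M≤′ = one-merge M≤′ u∈ v∈ u≢v ¬uv
    ...     | no M≰′ = avoid-u
      where
      ¬sym : ∀ {a b} → ¬ Adj H a b → ¬ Adj H b a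
      ¬sym ¬ab ba = ¬ab (adj-sym H ba)
      remaining : (w : Fin n) → ∣ ∁ M ∣ < ∣ M ∖ w ∣
      remaining w = ℕ.≤-pred (ℕ.≤-trans (ℕ.≰⇒> M≰′) (card≤suc-remove M w))
      pairs : ∀ {a b c d} → a ∈ M → b ∈ M → c ∈ M → d ∈ M → a ≢ b → c ≢ d → ¬ Adj H a b → ¬ Adj H c d →
        c ≢ a → c ≢ b → d ≢ a → d ≢ b → Colorable H L
      pairs a∈ b∈ c∈ d∈ a≢b c≢d ¬ab ¬cd c≢a c≢b d≢a d≢b =
        two-merges M≤ a∈ b∈ c∈ d∈ a≢b (d≢a ∘ sym) c≢b c≢d (d≢b ∘ sym) ¬ab ¬cd (λ a≡c → ⊥-elim (c≢a (sym a≡c)))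
      triple : ∀ {a b c} → a ∈ M → b ∈ M → c ∈ M → a ≢ b → a ≢ c → b ≢ c →
        ¬ Adj H a b → ¬ Adj H a c → ¬ Adj H b c → Colorable H L
      triple a∈ b∈ c∈ a≢b a≢c b≢c ¬ab ¬ac ¬bc =
        two-merges M≤ a∈ b∈ a∈ c∈ a≢b a≢c a≢b a≢c b≢c ¬ab ¬ac (λ _ → ¬bc)
      -- Two nonedges u v and v y share v; a nonedge avoiding v is disjoint from one of them or closes a triple.
      avoid-v : ∀ {y} → y ∈ M → y ≢ v → y ≢ u → ¬ Adj H v y → Colorable H L
      avoid-v {y} y∈ y≢v y≢u ¬vy with nonedge (M ∖ v) (proj₁ ∘ ∈-remove⁻ M) (remaining v)
      ... | p , q , p∈ , q∈ , p≢q , ¬pq with ∈-remove⁻ M p∈ | ∈-remove⁻ M q∈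
      ... | p∈M , p≢v | q∈M , q≢v with p ≟ u | q ≟ u
      ...   | yes refl | yes refl = ⊥-elim (p≢q refl)
      ...   | no p≢u | no q≢u = pairs u∈ v∈ p∈M q∈M u≢v p≢q ¬uv ¬pq p≢u p≢v q≢u q≢v
      ...   | yes refl | no _ with q ≟ y
      ...     | yes refl = triple u∈ v∈ y∈ u≢v (y≢u ∘ sym) (y≢v ∘ sym) ¬uv ¬pq ¬vy
      ...     | no q≢y = pairs v∈ y∈ p∈M q∈M (y≢v ∘ sym) p≢q ¬vy ¬pq p≢v (y≢u ∘ sym) q≢v q≢y
      avoid-v {y} y∈ y≢v y≢u ¬vy | p , q , p∈ , q∈ , p≢q , ¬pq | p∈M , p≢v | q∈M , q≢v | no _ | yes refl with p ≟ y
      ...     | yes refl = triple u∈ v∈ y∈ u≢v (y≢u ∘ sym) (y≢v ∘ sym) ¬uv (¬sym ¬pq) ¬vy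
      ...     | no p≢y = pairs v∈ y∈ p∈M q∈M (y≢v ∘ sym) p≢q ¬vy ¬pq p≢v p≢y q≢v (y≢u ∘ sym)
      avoid-u : Colorable H L
      avoid-u with nonedge (M ∖ u) (proj₁ ∘ ∈-remove⁻ M) (remaining u)
      ... | x , y , x∈ , y∈ , x≢y , ¬xy with ∈-remove⁻ M x∈ | ∈-remove⁻ M y∈
      ... | x∈M , x≢u | y∈M , y≢u with x ≟ v | y ≟ v
      ...   | yes refl | _        = avoid-v y∈M (x≢y ∘ sym) y≢u ¬xy
      ...   | no _     | yes refl = avoid-v x∈M x≢y x≢u (¬sym ¬xy)
      ...   | no x≢v   | no y≢v   = pairs u∈ v∈ x∈M y∈M u≢v x≢y ¬uv ¬xy x≢u x≢v y≢u y≢v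

    -- The edge relation of H[M].
    Inner : Fin n → Fin n → Set
    Inner u v = Adj H u v × u ∈ M × v ∈ M

    inner? : Decidable Inner
    inner? u v = adj? H u v ×-dec ((u ∈? M) ×-dec (v ∈? M))

    _∈ˡ?_ : (x : Fin n) (l : List (Fin n)) → Dec (x ∈ˡ l)
    _∈ˡ?_ = DecMembership._∈?_ _≟_

    -- An odd cycle on 2h + 1 vertices would have at most 2h vertices by Hall's condition.
    no-odd-cycle : ∣ ∁ M ∣ ≤ 2 → ¬ OddCycle Inner
    no-odd-cycle ∁M≤2 (u , v , l , p , (vu , v∈ , u∈) , uniq) with length-path p
    ... | h , len≡ = ℕ.<-irrefl refl (ℕ.≤-trans (ℕ.≤-reflexive (sym len≡)) (ℕ.≤-trans len≤ (ℕ.≤-trans T≤ bound)))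
      where
      T : Subset n
      T = ⟦ _∈ˡ? l ⟧
      T⊆M : T ⊆ M
      T⊆M x∈ = All.lookup (All-path (proj₂ ∘ proj₂) p u∈) (∈⟦⟧⁻ (_∈ˡ? l) x∈)
      len≤ : length l ≤ ∣ T ∣
      len≤ = length≤card id l uniq T (∈⟦⟧⁺ (_∈ˡ? l)) (λ _ _ eq → eq)
      T≤ : ∣ T ∣ ≤ ∣ ∁ M ∣ * h
      T≤ = hall-bound hall T (∁ M) (L-inner ∘ T⊆M) h λ X X⊆T ind →
        ℕ.≤-trans (card≤length X (filter (_∈? X) l) (λ x∈ → ∈-filter⁺ (_∈? X) (∈⟦⟧⁻ (_∈ˡ? l) (X⊆T x∈)) x∈))
          (half _ _ (subst (length (filter (_∈? X) l) * 2 ≤_) len≡ (hits-odd-cycle X (λ a a∈ b b∈ ab → ind a a∈ b b∈ (proj₁ ab)) p (vu , v∈ , u∈))))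
        where
        half : ∀ a b → a * 2 ≤ suc (b * 2) → a ≤ b
        half zero    b       _ = z≤n
        half (suc a) zero    (s≤s ())
        half (suc a) (suc b) (s≤s (s≤s le)) = s≤s (half a b le)
      bound : ∣ ∁ M ∣ * h ≤ h * 2
      bound = subst (∣ ∁ M ∣ * h ≤_) (ℕ.*-comm 2 h) (ℕ.*-monoˡ-≤ h ∁M≤2)

    -- With one colour outside M, an edge in M would be a clique that is too large.
    no-inner-edge : ∣ ∁ M ∣ ≤ 1 → ∀ {u v} → u ∈ M → v ∈ M → ¬ Adj H u v
    no-inner-edge ∁M≤1 {u} {v} u∈ v∈ uv with nonedge T T⊆M (ℕ.≤-trans (s≤s ∁M≤1) 2≤T)
      where
      pair = u ∷ v ∷ []
      T : Subset n
      T = ⟦ _∈ˡ? pair ⟧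
      T⊆M : T ⊆ M
      T⊆M x∈ = All.lookup (u∈ ∷ v∈ ∷ []) (∈⟦⟧⁻ (_∈ˡ? pair) x∈)
      2≤T : 2 ≤ ∣ T ∣
      2≤T = length≤card id pair (((λ u≡v → adj-irrefl H u≡v uv) ∷ []) ∷ [] ∷ []) T (∈⟦⟧⁺ (_∈ˡ? pair)) (λ _ _ eq → eq)
    ... | x , y , x∈ , y∈ , x≢y , ¬xy
      with ∈⟦⟧⁻ (_∈ˡ? (u ∷ v ∷ [])) x∈ | ∈⟦⟧⁻ (_∈ˡ? (u ∷ v ∷ [])) y∈
    ... | here refl         | here refl         = x≢y refl
    ... | here refl         | there (here refl) = ¬xy uv
    ... | there (here refl) | here refl         = ¬xy (adj-sym H uv)
    ... | there (here refl) | there (here refl) = x≢y refl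

    colourable-if-few-outside : ∣ ∁ M ∣ ≤ 2 → Colorable H L
    colourable-if-few-outside ∁M≤2 with nonempty? (∁ M)
    ... | no empty = merge-colouring id M (ℕ.≤-trans M≤0 z≤n) id (λ _ _ eq → adj-irrefl H eq)
      where
      M≤0 : ∣ M ∣ ≤ 0
      M≤0 = subst (λ a → ∣ M ∣ ≤ a * n) (empty⇒card≡0 (∁ M) empty)
        (hall-bound hall M (∁ M) L-inner n (λ X _ _ → ∣p∣≤n X))
    ... | yes (a , a∈) with nonempty? (∁ M ∖ a)
    ...   | no  empty = extend-colouring (λ _ → a) (λ _ → a∈)
      (λ u∈ v∈ uv _ → no-inner-edge (ℕ.≤-trans (card≤suc-remove (∁ M) a) (s≤s (ℕ.≤-reflexive (empty⇒card≡0 _ empty)))) u∈ v∈ uv)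
    ...   | yes (b , b∈) with oddCycle⊎twoColouring inner? (λ (uv , u∈ , v∈) → adj-sym H uv , v∈ , u∈)
    ...     | inj₁ cycle = ⊥-elim (no-odd-cycle ∁M≤2 cycle)
    ...     | inj₂ (c , proper) = extend-colouring (λ v → pick (c v)) (λ {v} _ → pick∈ (c v))
      (λ u∈ v∈ uv eq → proper _ _ (uv , u∈ , v∈) (pick-inj _ _ eq))
      where
      b≢a : b ≢ a
      b≢a = proj₂ (∈-remove⁻ (∁ M) b∈)
      pick : Bool → Fin n
      pick true  = a
      pick false = b
      pick∈ : ∀ d → pick d ∈ ∁ M
      pick∈ true  = a∈
      pick∈ false = proj₁ (∈-remove⁻ (∁ M) b∈)
      pick-inj : ∀ d e → pick d ≡ pick e → d ≡ e
      pick-inj true  true  _  = refl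
      pick-inj true  false eq = ⊥-elim (b≢a (sym eq))
      pick-inj false true  eq = ⊥-elim (b≢a eq)
      pick-inj false false _  = refl

-- Necessity: a join of a 5-cycle and a complete graph

-- Adjacency in the 5-cycle.
Cyclic : Fin 5 → Fin 5 → Set
Cyclic i j = suc (toℕ i) % 5 ≡ toℕ j ⊎ suc (toℕ j) % 5 ≡ toℕ i

cyclic? : Decidable Cyclic
cyclic? i j = (suc (toℕ i) % 5 ℕ.≟ toℕ j) ⊎-dec (suc (toℕ j) % 5 ℕ.≟ toℕ i)

cyclic-irrefl : ∀ i → ¬ Cyclic i i
cyclic-irrefl = from-yes (all? λ i → ¬? (cyclic? i i))

-- The join of a 5-cycle (the rim) with a complete graph on k + 1 vertices (the hubs).
Core : ℕ → Set
Core k = Fin 5 ⊎ Fin (suc k)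

CoreAdj : Core k → Core k → Set
CoreAdj (inj₁ i) (inj₁ j) = Cyclic i j
CoreAdj (inj₁ _) (inj₂ _) = Unit
CoreAdj (inj₂ _) (inj₁ _) = Unit
CoreAdj (inj₂ h) (inj₂ l) = h ≢ l

coreAdj? : Decidable (CoreAdj {k})
coreAdj? (inj₁ i) (inj₁ j) = cyclic? i j
coreAdj? (inj₁ _) (inj₂ _) = yes tt
coreAdj? (inj₂ _) (inj₁ _) = yes tt
coreAdj? (inj₂ h) (inj₂ l) = ¬? (h ≟ l)

coreAdj-sym : (c d : Core k) → CoreAdj c d → CoreAdj d c
coreAdj-sym (inj₁ i) (inj₁ j) = Sum.swap
coreAdj-sym (inj₁ _) (inj₂ _) = id
coreAdj-sym (inj₂ _) (inj₁ _) = id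
coreAdj-sym (inj₂ h) (inj₂ l) h≢l = h≢l ∘ sym

coreAdj-irrefl : (c : Core k) → ¬ CoreAdj c c
coreAdj-irrefl (inj₁ i) = cyclic-irrefl i
coreAdj-irrefl (inj₂ h) h≢h = h≢h refl

anyCore? : {P : Core k → Set} → (∀ c → Dec (P c)) → Dec (∃ P)
anyCore? P? = map′ [ (λ (i , p) → inj₁ i , p) , (λ (h , p) → inj₂ h , p) ]′
  (λ { (inj₁ i , p) → inj₁ (i , p) ; (inj₂ h , p) → inj₂ (h , p) })
  (any? (P? ∘ inj₁) ⊎-dec any? (P? ∘ inj₂))

splitAt-injective : ∀ m {i j : Fin (m + n)} → splitAt m i ≡ splitAt m j → i ≡ j
splitAt-injective {n} m {i} {j} eq =
  trans (sym (join-splitAt m n i)) (trans (cong (join m n) eq) (join-splitAt m n j))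

-- A 2-colouring of the 5-cycle minus the vertex i: the parity of the cyclic distance travelled from i.
alternate : Fin 5 → Fin 5 → Bool
alternate i j = does (((toℕ j + (5 ∸ toℕ i)) % 5) % 2 ℕ.≟ 0)

alternate-proper : ∀ i j l → j ≢ i → l ≢ i → alternate i j ≡ alternate i l → ¬ Cyclic j l
alternate-proper = from-yes (all? λ i → all? λ j → all? λ l →
  ¬? (j ≟ i) →-dec (¬? (l ≟ i) →-dec ((alternate i j Bool.≟ alternate i l) →-dec ¬? (cyclic? j l))))

-- A proper 3-colouring of the 5-cycle, with the third colour used only once.
rimColour : Fin 5 → Fin 3
rimColour 0F = 0F
rimColour 1F = 1F
rimColour 2F = 0F
rimColour 3F = 1F
rimColour 4F = 2F

rimColour-proper : ∀ i j → rimColour i ≡ rimColour j → ¬ Cyclic i j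
rimColour-proper = from-yes (all? λ i → all? λ j → (rimColour i ≟ rimColour j) →-dec ¬? (cyclic? i j))

-- Nonempty lists in which every vertex of M sees exactly the colours outside M.  With k + 3 colours outside M
-- and at least k + 6 vertices in M, the graph H satisfies Hall's condition and is not colourable.
module Counterexample {n k} (L : Lists n n) (M : Subset n)
  (L-inner : ∀ {v} → v ∈ M → L v ⊆ ∁ M)
  (inner-L : ∀ {v} → v ∈ M → ∁ M ⊆ L v)
  (L-nonempty : ∀ v → Nonempty (L v))
  (∁M≡ : ∣ ∁ M ∣ ≡ 3 + k) (≤M : 5 + suc k ≤ ∣ M ∣) where

  -- The colours outside M, numbered.
  paint-spec : ∃ λ (f : Fin (3 + k) → Fin n) → (∀ x → f x ∈ ∁ M) × (∀ {x y} → f x ≡ f y → x ≡ y)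
  paint-spec = enumerate (3 + k) (∁ M) (ℕ.≤-reflexive (sym ∁M≡))

  paint : Fin (3 + k) → Fin n
  paint = proj₁ paint-spec

  paint∈ : ∀ x → paint x ∈ ∁ M
  paint∈ = proj₁ (proj₂ paint-spec)

  paint-injective : ∀ {x y} → paint x ≡ paint y → x ≡ y
  paint-injective = proj₂ (proj₂ paint-spec)

  -- Distinct vertices of M that carry the core.
  embedding : ∃ λ (f : Fin (5 + suc k) → Fin n) → (∀ x → f x ∈ M) × (∀ {x y} → f x ≡ f y → x ≡ y)
  embedding = enumerate (5 + suc k) M ≤M

  place : Core k → Fin n
  place c = proj₁ embedding (join 5 (suc k) c)

  place∈ : ∀ c → place c ∈ M
  place∈ c = proj₁ (proj₂ embedding) (join 5 (suc k) c)

  place-injective : ∀ {c d} → place c ≡ place d → c ≡ d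
  place-injective {c} {d} eq = trans (sym (splitAt-join 5 (suc k) c))
    (trans (cong (splitAt 5) (proj₂ (proj₂ embedding) eq)) (splitAt-join 5 (suc k) d))

  locate : ∀ v → Dec (∃ λ c → place c ≡ v)
  locate v = anyCore? λ c → place c ≟ v

  -- The core inside M, and all other vertices isolated.
  H : Graph n
  H = record
    { Adj        = λ u v → ∃₂ λ c d → place c ≡ u × place d ≡ v × CoreAdj c d
    ; adj?       = λ u v → anyCore? λ c → anyCore? λ d → (place c ≟ u) ×-dec ((place d ≟ v) ×-dec coreAdj? c d)
    ; adj-sym    = λ (c , d , c≡ , d≡ , cd) → d , c , d≡ , c≡ , coreAdj-sym c d cd
    ; adj-irrefl = λ { refl (c , d , c≡ , d≡ , cd) →
        coreAdj-irrefl c (subst (CoreAdj c) (place-injective (trans d≡ (sym c≡))) cd) }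
    }

  Adj-place : ∀ {c d} → Adj H (place c) (place d) → CoreAdj c d
  Adj-place (c , d , c≡ , d≡ , cd) = subst₂ CoreAdj (place-injective c≡) (place-injective d≡) cd

  module _ (F : Subgraph H) where
    open Subgraph F

    -- A multicolouring of the core extends to F: the other vertices are isolated, so each takes any colour of
    -- its list and is its own carrier.
    core-multicolouring⇒Hall : (col : Core k → Fin (3 + k)) (w : Core k → Core k) →
      (∀ {c} → place c ∈ V → place (w c) ∈ V) →
      (∀ {c d} → place c ∈ V → place d ∈ V → col c ≡ col d → ¬ CoreAdj (w c) (w d)) →
      (∀ {c d} → col c ≡ col d → w c ≡ w d → c ≡ d) →
      ∣ V ∣ ≤ sum (λ σ → α F L σ)
    core-multicolouring⇒Hall col w w∈ proper inj = multicolouring⇒Hall F L φ carrier carrier∈ φ∈ φ-proper φ-inj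
      where
      φ : Fin n → Fin n
      φ v with locate v
      ... | yes (c , _) = paint (col c)
      ... | no  _       = proj₁ (L-nonempty v)
      carrier : Fin n → Fin n
      carrier v with locate v
      ... | yes (c , _) = place (w c)
      ... | no  _       = v
      carrier∈ : ∀ {v} → v ∈ V → carrier v ∈ V
      carrier∈ {v} v∈ with locate v
      ... | yes (c , refl) = w∈ v∈
      ... | no  _          = v∈
      φ∈ : ∀ {v} → v ∈ V → φ v ∈ L (carrier v)
      φ∈ {v} v∈ with locate v
      ... | yes (c , _) = inner-L (place∈ (w c)) (paint∈ (col c))
      ... | no  _       = proj₂ (L-nonempty v)
      φ-proper : ∀ {u v} → u ∈ V → v ∈ V → φ u ≡ φ v → ¬ E (carrier u) (carrier v)
      φ-proper {u} {v} u∈ v∈ eq e with locate u | locate v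
      ... | yes (c , refl) | yes (d , refl) = proper u∈ v∈ (paint-injective eq) (Adj-place (E⊆Adj e))
      ... | no u∉ | _     = let c , _ , c≡ , _ = E⊆Adj e in u∉ (c , c≡)
      ... | yes _ | no v∉ = let _ , d , _ , d≡ , _ = E⊆Adj e in v∉ (d , d≡)
      φ-inj : ∀ {u v} → u ∈ V → v ∈ V → φ u ≡ φ v → carrier u ≡ carrier v → u ≡ v
      φ-inj {u} {v} u∈ v∈ eq same with locate u | locate v
      ... | yes (c , refl) | yes (d , refl) = cong place (inj (paint-injective eq) (place-injective same))
      ... | yes (c , _)    | no v∉ = ⊥-elim (v∉ (w c , same))
      ... | no u∉ | yes (d , _) = ⊥-elim (u∉ (w d , sym same))
      ... | no _  | no _ = same

    -- All rim vertices are present.  The third rim colour is shared by rim vertex 4 and hub 0, and hub 0 has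
    -- rim vertex 2 as its carrier: it is not adjacent to rim vertex 4, and its own colour is a different one.
    hall-full-rim : (∀ i → place (inj₁ i) ∈ V) → ∣ V ∣ ≤ sum (λ σ → α F L σ)
    hall-full-rim rim∈ = core-multicolouring⇒Hall col w
      (λ {c} → w∈ c) (λ {c} {d} _ _ → proper c d) (λ {c} {d} → inj c d)
      where
      col : Core k → Fin (3 + k)
      col (inj₁ i) = rimColour i ↑ˡ k
      col (inj₂ h) = suc (suc h)
      w : Core k → Core k
      w (inj₁ i)       = inj₁ i
      w (inj₂ zero)    = inj₁ 2F
      w (inj₂ (suc h)) = inj₂ (suc h)
      w∈ : ∀ c → place c ∈ V → place (w c) ∈ V
      w∈ (inj₁ i)       c∈ = c∈
      w∈ (inj₂ zero)    c∈ = rim∈ 2F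
      w∈ (inj₂ (suc h)) c∈ = c∈
      rim-hub : ∀ i h → col (inj₁ i) ≡ col (inj₂ h) → i ≡ 4F × h ≡ zero
      rim-hub 4F zero _ = refl , refl
      rim-hub 4F (suc h) ()
      proper : ∀ c d → col c ≡ col d → ¬ CoreAdj (w c) (w d)
      proper (inj₁ i) (inj₁ j) eq = rimColour-proper i j (↑ˡ-injective k _ _ eq)
      proper (inj₁ i) (inj₂ h) eq with rim-hub i h eq
      ... | refl , refl = from-yes (¬? (cyclic? 4F 2F))
      proper (inj₂ h) (inj₁ i) eq with rim-hub i h (sym eq)
      ... | refl , refl = from-yes (¬? (cyclic? 2F 4F))
      proper (inj₂ h) (inj₂ l) eq with suc-injective (suc-injective eq)
      ... | refl = coreAdj-irrefl (w (inj₂ h))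
      inj : ∀ c d → col c ≡ col d → w c ≡ w d → c ≡ d
      inj (inj₁ i) (inj₁ j) _ same = same
      inj (inj₁ i) (inj₂ h) eq same with rim-hub i h eq
      inj (inj₁ .4F) (inj₂ .zero) eq () | refl , refl
      inj (inj₂ h) (inj₁ i) eq same with rim-hub i h (sym eq)
      inj (inj₂ .zero) (inj₁ .4F) eq () | refl , refl
      inj (inj₂ h) (inj₂ l) eq _ = cong inj₂ (suc-injective (suc-injective eq))

    -- A rim vertex is missing: two colours suffice for the rest of the rim, and the hubs get the other k + 1.
    hall-broken-rim : ∀ i → place (inj₁ i) ∉ V → ∣ V ∣ ≤ sum (λ σ → α F L σ)
    hall-broken-rim i i∉ = core-multicolouring⇒Hall col id id
      (λ {c} {d} → proper c d) (λ _ same → same)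
      where
      two : Bool → Fin (3 + k)
      two false = 0F
      two true  = 1F
      two-injective : ∀ a b → two a ≡ two b → a ≡ b
      two-injective false false _ = refl
      two-injective true  true  _ = refl
      two-injective false true ()
      two-injective true false ()
      col : Core k → Fin (3 + k)
      col (inj₁ j) = two (alternate i j)
      col (inj₂ h) = suc (suc h)
      two≢hub : ∀ b h → two b ≢ suc (suc h)
      two≢hub false h ()
      two≢hub true  h ()
      proper : ∀ c d → place c ∈ V → place d ∈ V → col c ≡ col d → ¬ CoreAdj c d
      proper (inj₁ j) (inj₁ l) j∈ l∈ eq = alternate-proper i j l
        (λ { refl → i∉ j∈ }) (λ { refl → i∉ l∈ }) (two-injective _ _ eq)
      proper (inj₁ j) (inj₂ h) _ _ eq _ = two≢hub (alternate i j) h eq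
      proper (inj₂ h) (inj₁ j) _ _ eq _ = two≢hub (alternate i j) h (sym eq)
      proper (inj₂ h) (inj₂ l) _ _ eq h≢l = h≢l (suc-injective (suc-injective eq))

  hall : HallCondition H L
  hall F with all? (λ i → place (inj₁ i) ∈? Subgraph.V F)
  ... | yes rim∈ = hall-full-rim F rim∈
  ... | no ¬rim∈ with any? (λ i → ¬? (place (inj₁ i) ∈? Subgraph.V F))
  ...   | yes (i , i∉) = hall-broken-rim F i i∉
  ...   | no none = ⊥-elim (¬rim∈ λ i → decidable-stable (_ ∈? _) λ i∉ → none (i , i∉))

  not-colourable : ¬ Colorable H L
  not-colourable (φ , φ∈ , φ-proper) =
    adjacent≢ 4F 0F (inj₁ refl) (sym (trans (third 0F 1F 2F (inj₁ refl) (inj₁ refl)) (third 2F 3F 4F (inj₁ refl) (inj₁ refl))))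
    where
    colour : Core k → Fin n
    colour c = φ (place c)
    colour≢ : ∀ c d → CoreAdj c d → colour c ≢ colour d
    colour≢ c d cd = φ-proper (place c) (place d) (c , d , refl , refl , cd)
    adjacent≢ : ∀ i j → Cyclic i j → colour (inj₁ i) ≢ colour (inj₁ j)
    adjacent≢ i j = colour≢ (inj₁ i) (inj₁ j)
    -- Hubs use k + 1 colours, none of which occurs on the rim, so at most two colours are left for the rim.
    third : ∀ i j l → Cyclic i j → Cyclic j l → colour (inj₁ i) ≡ colour (inj₁ l)
    third i j l ij jl = decidable-stable (colour (inj₁ i) ≟ colour (inj₁ l)) λ i≢l →
      ℕ.1+n≰n (ℕ.≤-trans (ℕ.≤-reflexive (sym (trans (∣⊤∣≡n (3 + suc k)) (ℕ.+-suc 3 k))))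
        (ℕ.≤-trans (card-injection (colour ∘ vertex ∘ splitAt 3) ⊤ (∁ M)
          (λ {x} _ → L-inner (place∈ (vertex (splitAt 3 x))) (φ∈ _))
          (λ _ _ eq → splitAt-injective 3 (vertex-inj i≢l _ _ eq))) (ℕ.≤-reflexive ∁M≡)))
      where
      vertex : Fin 3 ⊎ Fin (suc k) → Core k
      vertex (inj₁ 0F) = inj₁ i
      vertex (inj₁ 1F) = inj₁ j
      vertex (inj₁ 2F) = inj₁ l
      vertex (inj₂ h)  = inj₂ h
      vertex-inj : colour (inj₁ i) ≢ colour (inj₁ l) → ∀ x y → colour (vertex x) ≡ colour (vertex y) → x ≡ y
      vertex-inj i≢l (inj₁ 0F) (inj₁ 0F) _  = refl
      vertex-inj i≢l (inj₁ 0F) (inj₁ 1F) eq = ⊥-elim (adjacent≢ i j ij eq)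
      vertex-inj i≢l (inj₁ 0F) (inj₁ 2F) eq = ⊥-elim (i≢l eq)
      vertex-inj i≢l (inj₁ 1F) (inj₁ 0F) eq = ⊥-elim (adjacent≢ i j ij (sym eq))
      vertex-inj i≢l (inj₁ 1F) (inj₁ 1F) _  = refl
      vertex-inj i≢l (inj₁ 1F) (inj₁ 2F) eq = ⊥-elim (adjacent≢ j l jl eq)
      vertex-inj i≢l (inj₁ 2F) (inj₁ 0F) eq = ⊥-elim (i≢l (sym eq))
      vertex-inj i≢l (inj₁ 2F) (inj₁ 1F) eq = ⊥-elim (adjacent≢ j l jl (sym eq))
      vertex-inj i≢l (inj₁ 2F) (inj₁ 2F) _  = refl
      vertex-inj i≢l (inj₁ 0F) (inj₂ h)  eq = ⊥-elim (colour≢ (inj₁ i) (inj₂ h) tt eq)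
      vertex-inj i≢l (inj₁ 1F) (inj₂ h)  eq = ⊥-elim (colour≢ (inj₁ j) (inj₂ h) tt eq)
      vertex-inj i≢l (inj₁ 2F) (inj₂ h)  eq = ⊥-elim (colour≢ (inj₁ l) (inj₂ h) tt eq)
      vertex-inj i≢l (inj₂ h)  (inj₁ 0F) eq = ⊥-elim (colour≢ (inj₂ h) (inj₁ i) tt eq)
      vertex-inj i≢l (inj₂ h)  (inj₁ 1F) eq = ⊥-elim (colour≢ (inj₂ h) (inj₁ j) tt eq)
      vertex-inj i≢l (inj₂ h)  (inj₁ 2F) eq = ⊥-elim (colour≢ (inj₂ h) (inj₁ l) tt eq)
      vertex-inj i≢l (inj₂ h)  (inj₂ h′) eq =
        cong inj₂ (decidable-stable (h ≟ h′) λ h≢h′ → colour≢ (inj₂ h) (inj₂ h′) h≢h′ eq)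

-- Reading the condition from the partition

f≤foldr-⊔ : (f : Fin r → ℕ) → ∀ i → f i ≤ foldr _⊔_ 0 f
f≤foldr-⊔ f zero    = ℕ.m≤m⊔n _ _
f≤foldr-⊔ f (suc i) = ℕ.≤-trans (f≤foldr-⊔ (f ∘ suc) i) (ℕ.m≤n⊔m (f zero) _)

foldr-⊔-attained : (f : Fin (suc r) → ℕ) → ∃ λ i → f i ≡ foldr _⊔_ 0 f
foldr-⊔-attained {zero}  f = zero , sym (ℕ.⊔-identityʳ (f zero))
foldr-⊔-attained {suc r} f with foldr-⊔-attained (f ∘ suc) | ℕ.⊔-sel (f zero) (foldr _⊔_ 0 (f ∘ suc))
... | _ , _  | inj₁ eq = zero , sym eq
... | i , fi | inj₂ eq = suc i , trans fi (sym eq)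

m-n≤k⇔m≤n+k : ∀ m n k → ((+ m) - (+ n) ≤ᶻ + k) ⇔ (m ≤ n + k)
m-n≤k⇔m≤n+k m n k = mk⇔ to from
  where
  to : (+ m) - (+ n) ≤ᶻ + k → m ≤ n + k
  to le = ℤ.drop‿+≤+ (ℤ.≤-trans (ℤ.≤-reflexive (sym cancel)) (ℤ.≤-trans (ℤ.+-monoˡ-≤ (+ n) le) (ℤ.≤-reflexive (cong +_ (ℕ.+-comm k n)))))
    where
    cancel : ((+ m) - (+ n)) +ᶻ (+ n) ≡ + m
    cancel = trans (ℤ.+-assoc (+ m) (-ᶻ (+ n)) (+ n)) (trans (cong (λ z → (+ m) +ᶻ z) (ℤ.+-inverseˡ (+ n))) (ℤ.+-identityʳ _))
  from : m ≤ n + k → (+ m) - (+ n) ≤ᶻ + k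
  from le = ℤ.≤-trans (ℤ.+-monoˡ-≤ (-ᶻ (+ n)) (+≤+ le)) (ℤ.≤-reflexive cancel)
    where
    cancel : + (n + k) - (+ n) ≡ + k
    cancel = trans (ℤ.m-n≡m⊖n (n + k) n) (trans (ℤ.⊖-≥ (ℕ.m≤m+n n k)) (cong +_ (ℕ.m+n∸m≡n n k)))

theorem4p15 : (n r : ℕ) → 2 ≤ r →
    (A : Partition n r) (G : Graph n) → G ≅ completeMultipartite A →
    HallUniversal G ⇔
    ((+ n) - (+ maxPart A) ≤ᶻ (+ 2) ⊎ (+ 2) *ᶻ (+ maxPart A) - (+ n) ≤ᶻ (+ 2))
theorem4p15 n (suc r) 2≤r A G iso = mk⇔ necessary sufficient
  where
  open _≅_ iso
  a = maxPart A

  -- The index of the part that contains a vertex of G, read through the isomorphism.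
  p : Fin n → Fin (suc r)
  p v = proj₁ (covers A (bijection ⟨$⟩ʳ v))

  p∈ : ∀ v → bijection ⟨$⟩ʳ v ∈ part A (p v)
  p∈ v = proj₁ (proj₂ (covers A (bijection ⟨$⟩ʳ v)))

  p-unique : ∀ v {i} → bijection ⟨$⟩ʳ v ∈ part A i → p v ≡ i
  p-unique v = proj₂ (proj₂ (covers A (bijection ⟨$⟩ʳ v)))

  adj⁺ : ∀ {u v} → p u ≢ p v → v ∈ neighborhood G u
  adj⁺ {u} {v} ne = ∈⟦⟧⁺ (adj? G u) (Equivalence.from (preserves u v) (p u , p v , ne , p∈ u , p∈ v))

  adj⁻ : ∀ {u v} → v ∈ neighborhood G u → p u ≢ p v
  adj⁻ {u} {v} v∈ pu≡pv with Equivalence.to (preserves u v) (∈⟦⟧⁻ (adj? G u) v∈)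
  ... | i , j , i≢j , u∈ , v∈′ = i≢j (trans (sym (p-unique u u∈)) (trans pu≡pv (p-unique v v∈′)))

  cell≤part : ∀ i → ∣ cell p i ∣ ≤ ∣ part A i ∣
  cell≤part i = card-injection (bijection ⟨$⟩ʳ_) (cell p i) (part A i)
    (λ {v} v∈ → subst (λ j → bijection ⟨$⟩ʳ v ∈ part A j) (∈⟦⟧⁻ (λ v → p v ≟ i) v∈) (p∈ v))
    (λ _ _ eq → trans (sym (inverseˡ bijection)) (trans (cong (bijection ⟨$⟩ˡ_) eq) (inverseˡ bijection)))

  part≤cell : ∀ i → ∣ part A i ∣ ≤ ∣ cell p i ∣
  part≤cell i = card-injection (bijection ⟨$⟩ˡ_) (part A i) (cell p i)
    (λ {v} v∈ → ∈⟦⟧⁺ (λ v → p v ≟ i) (p-unique (bijection ⟨$⟩ˡ v) (subst (_∈ part A i) (sym (inverseʳ bijection)) v∈)))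
    (λ _ _ eq → trans (sym (inverseʳ bijection)) (trans (cong (bijection ⟨$⟩ʳ_) eq) (inverseʳ bijection)))

  cell≤a : ∀ i → ∣ cell p i ∣ ≤ a
  cell≤a i = ℕ.≤-trans (cell≤part i) (f≤foldr-⊔ (λ i → ∣ part A i ∣) i)

  largest : ∃ λ i → ∣ part A i ∣ ≡ a
  largest = foldr-⊔-attained (λ i → ∣ part A i ∣)

  i₀ = proj₁ largest

  M : Subset n
  M = cell p i₀

  M≡a : ∣ M ∣ ≡ a
  M≡a = trans (ℕ.≤-antisym (cell≤part i₀) (part≤cell i₀)) (proj₂ largest)

  a+∁M : a + ∣ ∁ M ∣ ≡ n
  a+∁M = trans (cong₂ _+_ (sym M≡a) (∣∁p∣≡n∸∣p∣ M)) (ℕ.m+[n∸m]≡n (∣p∣≤n M))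

  few⇔ : ((+ n) - (+ a) ≤ᶻ + 2) ⇔ (∣ ∁ M ∣ ≤ 2)
  few⇔ = mk⇔
    (λ le → ℕ.+-cancelˡ-≤ a _ _ (subst (_≤ a + 2) (sym a+∁M) (Equivalence.to (m-n≤k⇔m≤n+k n a 2) le)))
    (λ le → Equivalence.from (m-n≤k⇔m≤n+k n a 2) (subst (_≤ a + 2) a+∁M (ℕ.+-monoʳ-≤ a le)))

  balanced⇔ : ((+ 2) *ᶻ (+ a) - (+ n) ≤ᶻ + 2) ⇔ (∣ M ∣ ≤ suc (suc ∣ ∁ M ∣))
  balanced⇔ = mk⇔
    (λ le → ℕ.+-cancelˡ-≤ a _ _ (subst₂ _≤_ (sym double) regroup
      (Equivalence.to (m-n≤k⇔m≤n+k (2 * a) n 2) (subst (λ z → z - (+ n) ≤ᶻ + 2) (sym (ℤ.pos-* 2 a)) le))))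
    (λ le → subst (λ z → z - (+ n) ≤ᶻ + 2) (ℤ.pos-* 2 a)
      (Equivalence.from (m-n≤k⇔m≤n+k (2 * a) n 2) (subst₂ _≤_ double (sym regroup) (ℕ.+-monoʳ-≤ a le))))
    where
    double : a + ∣ M ∣ ≡ 2 * a
    double = cong (λ x → a + x) (trans M≡a (sym (ℕ.+-identityʳ a)))
    regroup : n + 2 ≡ a + suc (suc ∣ ∁ M ∣)
    regroup = trans (cong (_+ 2) (sym a+∁M)) (trans (ℕ.+-assoc a _ 2) (cong (λ x → a + x) (ℕ.+-comm _ 2)))

  M⁺ : ∀ {v} → p v ≡ i₀ → v ∈ M
  M⁺ = ∈⟦⟧⁺ (λ v → p v ≟ i₀)

  M⁻ : ∀ {v} → v ∈ M → p v ≡ i₀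
  M⁻ = ∈⟦⟧⁻ (λ v → p v ≟ i₀)

  L = neighborhood G

  L-inner : ∀ {v} → v ∈ M → L v ⊆ ∁ M
  L-inner v∈ u∈ = x∉p⇒x∈∁p λ u∈M → adj⁻ u∈ (trans (M⁻ v∈) (sym (M⁻ u∈M)))

  inner-L : ∀ {v} → v ∈ M → ∁ M ⊆ L v
  inner-L v∈ u∈ = adj⁺ λ eq → x∈∁p⇒x∉p u∈ (M⁺ (trans (sym eq) (M⁻ v∈)))

  outer-L : ∀ {v} → v ∉ M → M ⊆ L v
  outer-L v∉ u∈ = adj⁺ λ eq → v∉ (M⁺ (trans eq (M⁻ u∈)))

  sufficient : _ → HallUniversal G
  sufficient bound H hall with ∣ ∁ M ∣ ℕ.≤? ∣ M ∣
  ... | no ∁M≰M = let π , good = deranging-permutation p a cell≤a 2a≤n (allFin n) in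
    (π ⟨$⟩ʳ_) , (λ v → adj⁺ (λ eq → good (∈-allFin v) (sym eq))) , λ u v uv eq →
      adj-irrefl H (trans (sym (inverseˡ π)) (trans (cong (π ⟨$⟩ˡ_) eq) (inverseˡ π))) uv
    where
    2a≤n : a + a ≤ n
    2a≤n = ℕ.≤-trans (ℕ.+-monoʳ-≤ a (ℕ.≤-trans (ℕ.≤-reflexive (sym M≡a)) (ℕ.≰⇒≥ ∁M≰M))) (ℕ.≤-reflexive a+∁M)
  ... | yes ∁M≤M with bound
  ...   | inj₁ few = Split.colourable-if-few-outside H L M L-inner inner-L outer-L ∁M≤M hall
    (Equivalence.to few⇔ few)
  ...   | inj₂ balanced = Split.colourable-if-balanced H L M L-inner inner-L outer-L ∁M≤M hall
    (Equivalence.to balanced⇔ balanced)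
  necessary : HallUniversal G → _
  necessary universal with ∣ ∁ M ∣ ℕ.≤? 2 | ∣ M ∣ ℕ.≤? suc (suc ∣ ∁ M ∣)
  ... | yes few | _ = inj₁ (Equivalence.from few⇔ few)
  ... | no _ | yes balanced = inj₂ (Equivalence.from balanced⇔ balanced)
  ... | no many | no unbalanced = ⊥-elim (not-colourable (universal H hall))
    where
    -- The counterexample has 3 + j colours outside M.
    j : ℕ
    j = ∣ ∁ M ∣ ∸ 3
    ∁M≡ : ∣ ∁ M ∣ ≡ 3 + j
    ∁M≡ = sym (ℕ.m+[n∸m]≡n (ℕ.≰⇒> many))
    L-nonempty : ∀ v → Nonempty (L v)
    L-nonempty v with v ∈? M
    ... | yes v∈ = let u , u∈ = card>0⇒nonempty (∁ M) (ℕ.≤-trans (s≤s z≤n) (ℕ.≰⇒> many)) in u , inner-L v∈ u∈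
    ... | no  v∉ = let u , u∈ = card>0⇒nonempty M (ℕ.≤-trans (s≤s z≤n) (ℕ.≰⇒> unbalanced)) in u , outer-L v∉ u∈
    ≤M : 5 + suc j ≤ ∣ M ∣
    ≤M = ℕ.≤-trans (ℕ.≤-reflexive (trans (ℕ.+-suc 5 j) (sym (cong (λ x → 3 + x) ∁M≡)))) (ℕ.≰⇒> unbalanced)
    open Counterexample L M L-inner inner-L L-nonempty ∁M≡ ≤M
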